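{- Let $t \geq 3$ and let $\Delta$ be a graph on $n$ vertices with exactly $t$ distinct valencies. Then there exists a connected graph on at most $2^{n+2}$ vertices whose adjacency matrix has exactly four distinct eigenvalues, which has at least $t$ distinct valencies, and which contains $\Delta$ as an induced subgraph.
   Context: Graphs are finite, simple and undirected; eigenvalues of a graph are those of its adjacency matrix; valencies are vertex degrees. -}

module Defs where

open import Level using (0ℓ)
open import Algebra.Bundles using (CommutativeRing)
import Algebra.Definitions.RawMonoid as Sum
open import Data.Bool.Base using (Bool; true; false; if_then_else_)
open import Data.Fin.Base using (Fin)
open import Data.Fin.Subset using (Subset; ∣_∣)
open import Data.List.Base using (List; length; map; deduplicate; allFin)
open import Data.Nat.Base as ℕ using (ℕ)
import Data.Nat.Properties as ℕ
open import Data.Product.Base using (_×_; _,_; ∃-syntax; Σ-syntax)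
open import Data.Rational.Base as ℚ using (ℚ; 0ℚ; 1ℚ; ½)
import Data.Rational.Properties as ℚ
open import Data.Rational.Solver using (module +-*-Solver)
open import Data.Vec.Base using (tabulate)
open import Data.Vec.Functional using (Vector)
open import Function.Definitions using (Injective)
open import Relation.Binary.Construct.Closure.ReflexiveTransitive using (Star)
open import Relation.Binary.PropositionalEquality
  using (_≡_; _≢_; refl; sym; cong; subst; module ≡-Reasoning)
open import Relation.Binary.Structures using (IsEquivalence)

Eventually : (ℕ → Set) → Set
Eventually P = ∃[ N ] (∀ n → N ℕ.≤ n → P n)

Close : ℚ → ℚ → ℚ → Set
Close ε p q = ℚ.∣ p ℚ.- q ∣ ℚ.< ε

IsCauchy : (ℕ → ℚ) → Set
IsCauchy s = ∀ ε → 0ℚ ℚ.< ε →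
  ∃[ N ] (∀ m n → N ℕ.≤ m → N ℕ.≤ n → Close ε (s m) (s n))

-- Real numbers are Cauchy sequences of rationals, taken up to the setoid
-- equality _≃_ below (differing by a null sequence).
record ℝ : Set where
  constructor mkℝ
  no-eta-equality
  field
    seq    : ℕ → ℚ
    cauchy : IsCauchy seq

open ℝ public

infix 4 _≃_ _#_

_≃_ : ℝ → ℝ → Set
x ≃ y = ∀ ε → 0ℚ ℚ.< ε → Eventually λ n → Close ε (seq x n) (seq y n)

-- Apartness, the positive form of x ≄ y (classically equivalent to it).
_#_ : ℝ → ℝ → Set
x # y = ∃[ ε ] (0ℚ ℚ.< ε × Eventually λ n → ε ℚ.≤ ℚ.∣ seq x n ℚ.- seq y n ∣)

½-pos : ∀ {ε} → 0ℚ ℚ.< ε → 0ℚ ℚ.< ½ ℚ.* ε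
½-pos {ε} 0<ε = ℚ.positive⁻¹ (½ ℚ.* ε) {{ℚ.pos*pos⇒pos ½ ε {{ℚ.positive 0<ε}}}}

halves : ∀ ε → ½ ℚ.* ε ℚ.+ ½ ℚ.* ε ≡ ε
halves = solve 1 (λ e → con ½ :* e :+ con ½ :* e := e) refl
  where open +-*-Solver

close-self : ∀ {ε} p → 0ℚ ℚ.< ε → Close ε p p
close-self {ε} p = subst (ℚ._< ε) (sym (cong ℚ.∣_∣ (ℚ.+-inverseʳ p)))

close-sym : ∀ {ε} p q → Close ε p q → Close ε q p
close-sym {ε} p q = subst (ℚ._< ε) (begin
  ℚ.∣ p ℚ.- q ∣          ≡⟨ ℚ.∣-p∣≡∣p∣ (p ℚ.- q) ⟨
  ℚ.∣ ℚ.- (p ℚ.- q) ∣    ≡⟨ cong ℚ.∣_∣ (solve 2 (λ a b → :- (a :- b) := b :- a) refl p q) ⟩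
  ℚ.∣ q ℚ.- p ∣          ∎)
  where
  open +-*-Solver
  open ≡-Reasoning

close-+ : ∀ {ε} p p′ q q′ → Close (½ ℚ.* ε) p p′ → Close (½ ℚ.* ε) q q′ →
          Close ε (p ℚ.+ q) (p′ ℚ.+ q′)
close-+ {ε} p p′ q q′ a b = begin-strict
  ℚ.∣ (p ℚ.+ q) ℚ.- (p′ ℚ.+ q′) ∣          ≡⟨ cong ℚ.∣_∣ (solve 4 (λ p p′ q q′ →
                                               (p :+ q) :- (p′ :+ q′) := (p :- p′) :+ (q :- q′)) refl p p′ q q′) ⟩
  ℚ.∣ (p ℚ.- p′) ℚ.+ (q ℚ.- q′) ∣          ≤⟨ ℚ.∣p+q∣≤∣p∣+∣q∣ (p ℚ.- p′) (q ℚ.- q′) ⟩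
  ℚ.∣ p ℚ.- p′ ∣ ℚ.+ ℚ.∣ q ℚ.- q′ ∣        <⟨ ℚ.+-mono-< a b ⟩
  ½ ℚ.* ε ℚ.+ ½ ℚ.* ε                      ≡⟨ halves ε ⟩
  ε                                        ∎
  where
  open +-*-Solver
  open ℚ.≤-Reasoning

close-trans : ∀ {ε} p q r → Close (½ ℚ.* ε) p q → Close (½ ℚ.* ε) q r → Close ε p r
close-trans {ε} p q r a b = subst (ℚ._< ε)
  (cong ℚ.∣_∣ (solve 3 (λ p q r → (p :+ q) :- (q :+ r) := p :- r) refl p q r))
  (close-+ p q q r a b)
  where open +-*-Solver

close-neg : ∀ {ε} p q → Close ε p q → Close ε (ℚ.- p) (ℚ.- q)
close-neg {ε} p q a = subst (ℚ._< ε)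
  (cong ℚ.∣_∣ (solve 2 (λ a b → b :- a := (:- a) :- (:- b)) refl p q))
  (close-sym p q a)
  where open +-*-Solver

close-* : ∀ {P Q δ} p p′ q q′ → 0ℚ ℚ.< δ → ℚ.∣ p ∣ ℚ.< P → ℚ.∣ q′ ∣ ℚ.< Q →
          Close δ p p′ → Close δ q q′ →
          Close ((P ℚ.+ Q) ℚ.* δ) (p ℚ.* q) (p′ ℚ.* q′)
close-* {P} {Q} {δ} p p′ q q′ 0<δ p<P q<Q a b = begin-strict
  ℚ.∣ p ℚ.* q ℚ.- p′ ℚ.* q′ ∣
    ≡⟨ cong ℚ.∣_∣ (solve 4 (λ p p′ q q′ → p :* q :- p′ :* q′ := p :* (q :- q′) :+ q′ :* (p :- p′)) refl p p′ q q′) ⟩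
  ℚ.∣ p ℚ.* (q ℚ.- q′) ℚ.+ q′ ℚ.* (p ℚ.- p′) ∣
    ≤⟨ ℚ.∣p+q∣≤∣p∣+∣q∣ (p ℚ.* (q ℚ.- q′)) (q′ ℚ.* (p ℚ.- p′)) ⟩
  ℚ.∣ p ℚ.* (q ℚ.- q′) ∣ ℚ.+ ℚ.∣ q′ ℚ.* (p ℚ.- p′) ∣
    <⟨ ℚ.+-mono-< (bound p (q ℚ.- q′) p<P b) (bound q′ (p ℚ.- p′) q<Q a) ⟩
  P ℚ.* δ ℚ.+ Q ℚ.* δ
    ≡⟨ ℚ.*-distribʳ-+ δ P Q ⟨
  (P ℚ.+ Q) ℚ.* δ ∎
  where
  open +-*-Solver
  open ℚ.≤-Reasoning
  bound : ∀ {R} r s → ℚ.∣ r ∣ ℚ.< R → ℚ.∣ s ∣ ℚ.< δ → ℚ.∣ r ℚ.* s ∣ ℚ.< R ℚ.* δ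
  bound {R} r s r<R s<δ = begin-strict
    ℚ.∣ r ℚ.* s ∣          ≡⟨ ℚ.∣p*q∣≡∣p∣*∣q∣ r s ⟩
    ℚ.∣ r ∣ ℚ.* ℚ.∣ s ∣    ≤⟨ ℚ.*-monoˡ-≤-nonNeg ℚ.∣ r ∣ {{ℚ.∣-∣-nonNeg r}} (ℚ.<⇒≤ s<δ) ⟩
    ℚ.∣ r ∣ ℚ.* δ          <⟨ ℚ.*-monoˡ-<-pos δ {{ℚ.positive 0<δ}} r<R ⟩
    R ℚ.* δ                ∎

bounded : ∀ x → ∃[ B ] (0ℚ ℚ.< B × Eventually λ n → ℚ.∣ seq x n ∣ ℚ.< B)
bounded x with cauchy x 1ℚ (ℚ.positive⁻¹ 1ℚ)
... | N , close = B , 0<B , N , λ n N≤n → begin-strict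
  ℚ.∣ seq x n ∣                               ≡⟨ cong ℚ.∣_∣ (solve 2 (λ a b → a := (a :- b) :+ b) refl (seq x n) (seq x N)) ⟩
  ℚ.∣ (seq x n ℚ.- seq x N) ℚ.+ seq x N ∣     ≤⟨ ℚ.∣p+q∣≤∣p∣+∣q∣ (seq x n ℚ.- seq x N) (seq x N) ⟩
  ℚ.∣ seq x n ℚ.- seq x N ∣ ℚ.+ ℚ.∣ seq x N ∣ <⟨ ℚ.+-monoˡ-< ℚ.∣ seq x N ∣ (close n N N≤n ℕ.≤-refl) ⟩
  B                                           ∎
  where
  open +-*-Solver
  open ℚ.≤-Reasoning
  B : ℚ
  B = 1ℚ ℚ.+ ℚ.∣ seq x N ∣
  0<B : 0ℚ ℚ.< B
  0<B = ℚ.positive⁻¹ B {{ℚ.pos+nonNeg⇒pos 1ℚ ℚ.∣ seq x N ∣ {{ℚ.∣-∣-nonNeg (seq x N)}}}}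

scale : ∀ {C ε} → 0ℚ ℚ.< C → 0ℚ ℚ.< ε → ∃[ δ ] (0ℚ ℚ.< δ × C ℚ.* δ ≡ ε)
scale {C} {ε} 0<C 0<ε = δ , 0<δ , (begin
  C ℚ.* (C⁻¹ ℚ.* ε)    ≡⟨ ℚ.*-assoc C C⁻¹ ε ⟨
  (C ℚ.* C⁻¹) ℚ.* ε    ≡⟨ cong (ℚ._* ε) (ℚ.*-inverseʳ C) ⟩
  1ℚ ℚ.* ε             ≡⟨ ℚ.*-identityˡ ε ⟩
  ε                    ∎)
  where
  open ≡-Reasoning
  instance
    C-pos : ℚ.Positive C
    C-pos = ℚ.positive 0<C
    C-nonZero : ℚ.NonZero C
    C-nonZero = ℚ.pos⇒nonZero C
  C⁻¹ δ : ℚ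
  C⁻¹ = ℚ.1/ C
  δ = C⁻¹ ℚ.* ε
  0<δ : 0ℚ ℚ.< δ
  0<δ = ℚ.positive⁻¹ δ {{ℚ.pos*pos⇒pos C⁻¹ {{ℚ.1/pos⇒pos C}} ε {{ℚ.positive 0<ε}}}}

⊔ˡ : ∀ {M N k} → M ℕ.⊔ N ℕ.≤ k → M ℕ.≤ k
⊔ˡ {M} {N} = ℕ.m⊔n≤o⇒m≤o M N

⊔ʳ : ∀ {M N k} → M ℕ.⊔ N ℕ.≤ k → N ℕ.≤ k
⊔ʳ {M} {N} = ℕ.m⊔n≤o⇒n≤o M N

abstract

  const-cauchy : ∀ q → IsCauchy (λ _ → q)
  const-cauchy q ε 0<ε = 0 , λ _ _ _ _ → close-self q 0<ε

  +-cauchy : ∀ x y → IsCauchy (λ n → seq x n ℚ.+ seq y n)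
  +-cauchy x y ε 0<ε =
    let M , f = cauchy x (½ ℚ.* ε) (½-pos 0<ε)
        N , g = cauchy y (½ ℚ.* ε) (½-pos 0<ε)
    in M ℕ.⊔ N , λ m n h k →
      close-+ (seq x m) (seq x n) (seq y m) (seq y n) (f m n (⊔ˡ h) (⊔ˡ k)) (g m n (⊔ʳ h) (⊔ʳ k))

  neg-cauchy : ∀ x → IsCauchy (λ n → ℚ.- seq x n)
  neg-cauchy x ε 0<ε =
    let N , f = cauchy x ε 0<ε in
    N , λ m n h k → close-neg (seq x m) (seq x n) (f m n h k)

  *-cauchy : ∀ x y → IsCauchy (λ n → seq x n ℚ.* seq y n)
  *-cauchy x y ε 0<ε =
    let P , 0<P , K , p = bounded x
        Q , 0<Q , L , q = bounded y
        δ , 0<δ , eq = scale {P ℚ.+ Q} (ℚ.+-mono-< 0<P 0<Q) 0<ε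
        M , f = cauchy x δ 0<δ
        N , g = cauchy y δ 0<δ
    in (K ℕ.⊔ L) ℕ.⊔ (M ℕ.⊔ N) , λ m n h k →
      subst (λ e → Close e (seq x m ℚ.* seq y m) (seq x n ℚ.* seq y n)) eq
        (close-* (seq x m) (seq x n) (seq y m) (seq y n) 0<δ
          (p m (⊔ˡ (⊔ˡ h))) (q n (⊔ʳ {K} (⊔ˡ k)))
          (f m n (⊔ˡ (⊔ʳ {K ℕ.⊔ L} h)) (⊔ˡ (⊔ʳ {K ℕ.⊔ L} k)))
          (g m n (⊔ʳ {M} (⊔ʳ {K ℕ.⊔ L} h)) (⊔ʳ {M} (⊔ʳ {K ℕ.⊔ L} k))))

fromℚ : ℚ → ℝ
fromℚ q = mkℝ (λ _ → q) (const-cauchy q)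

0ℝ 1ℝ : ℝ
0ℝ = fromℚ 0ℚ
1ℝ = fromℚ 1ℚ

infixl 6 _+ℝ_
infixl 7 _*ℝ_
infix  8 -ℝ_

_+ℝ_ _*ℝ_ : ℝ → ℝ → ℝ
x +ℝ y = mkℝ (λ n → seq x n ℚ.+ seq y n) (+-cauchy x y)
x *ℝ y = mkℝ (λ n → seq x n ℚ.* seq y n) (*-cauchy x y)

-ℝ_ : ℝ → ℝ
-ℝ x = mkℝ (λ n → ℚ.- seq x n) (neg-cauchy x)

abstract

  pointwise : ∀ x y → (∀ n → seq x n ≡ seq y n) → x ≃ y
  pointwise x y eq ε 0<ε = 0 , λ n _ → subst (Close ε (seq x n)) (eq n) (close-self (seq x n) 0<ε)

  ≃-isEquivalence : IsEquivalence _≃_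
  ≃-isEquivalence = record
    { refl  = λ {x} → pointwise x x (λ _ → refl)
    ; sym   = λ {x} {y} x≃y ε 0<ε → let N , f = x≃y ε 0<ε in
        N , λ n h → close-sym (seq x n) (seq y n) (f n h)
    ; trans = λ {x} {y} {z} x≃y y≃z ε 0<ε →
        let M , f = x≃y (½ ℚ.* ε) (½-pos 0<ε)
            N , g = y≃z (½ ℚ.* ε) (½-pos 0<ε)
        in M ℕ.⊔ N , λ n h → close-trans (seq x n) (seq y n) (seq z n) (f n (⊔ˡ h)) (g n (⊔ʳ h))
    }

  +-congℝ : ∀ {x y u v} → x ≃ y → u ≃ v → x +ℝ u ≃ y +ℝ v
  +-congℝ {x} {y} {u} {v} x≃y u≃v ε 0<ε =
    let M , f = x≃y (½ ℚ.* ε) (½-pos 0<ε)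
        N , g = u≃v (½ ℚ.* ε) (½-pos 0<ε)
    in M ℕ.⊔ N , λ n h → close-+ (seq x n) (seq y n) (seq u n) (seq v n) (f n (⊔ˡ h)) (g n (⊔ʳ h))

  *-congℝ : ∀ {x y u v} → x ≃ y → u ≃ v → x *ℝ u ≃ y *ℝ v
  *-congℝ {x} {y} {u} {v} x≃y u≃v ε 0<ε =
    let P , 0<P , K , p = bounded x
        Q , 0<Q , L , q = bounded v
        δ , 0<δ , eq = scale {P ℚ.+ Q} (ℚ.+-mono-< 0<P 0<Q) 0<ε
        M , f = x≃y δ 0<δ
        N , g = u≃v δ 0<δ
    in (K ℕ.⊔ L) ℕ.⊔ (M ℕ.⊔ N) , λ n h →
      subst (λ e → Close e (seq x n ℚ.* seq u n) (seq y n ℚ.* seq v n)) eq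
        (close-* (seq x n) (seq y n) (seq u n) (seq v n) 0<δ
          (p n (⊔ˡ (⊔ˡ h))) (q n (⊔ʳ {K} (⊔ˡ h)))
          (f n (⊔ˡ (⊔ʳ {K ℕ.⊔ L} h)))
          (g n (⊔ʳ {M} (⊔ʳ {K ℕ.⊔ L} h))))

  neg-congℝ : ∀ {x y} → x ≃ y → -ℝ x ≃ -ℝ y
  neg-congℝ {x} {y} x≃y ε 0<ε =
    let N , f = x≃y ε 0<ε in
    N , λ n h → close-neg (seq x n) (seq y n) (f n h)

ℝ-commutativeRing : CommutativeRing 0ℓ 0ℓ
ℝ-commutativeRing = record
  { Carrier = ℝ ; _≈_ = _≃_ ; _+_ = _+ℝ_ ; _*_ = _*ℝ_ ; -_ = -ℝ_ ; 0# = 0ℝ ; 1# = 1ℝ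
  ; isCommutativeRing = record
    { isRing = record
      { +-isAbelianGroup = record
        { isGroup = record
          { isMonoid = record
            { isSemigroup = record
              { isMagma = record
                { isEquivalence = ≃-isEquivalence
                ; ∙-cong = λ {x} {y} {u} {v} → +-congℝ {x} {y} {u} {v}
                }
              ; assoc = λ x y z → pointwise ((x +ℝ y) +ℝ z) (x +ℝ (y +ℝ z))
                  λ n → ℚ.+-assoc (seq x n) (seq y n) (seq z n)
              }
            ; identity = (λ x → pointwise (0ℝ +ℝ x) x λ n → ℚ.+-identityˡ (seq x n))
                       , (λ x → pointwise (x +ℝ 0ℝ) x λ n → ℚ.+-identityʳ (seq x n))
            }
          ; inverse = (λ x → pointwise (-ℝ x +ℝ x) 0ℝ λ n → ℚ.+-inverseˡ (seq x n))
                    , (λ x → pointwise (x +ℝ -ℝ x) 0ℝ λ n → ℚ.+-inverseʳ (seq x n))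
          ; ⁻¹-cong = λ {x} {y} → neg-congℝ {x} {y}
          }
        ; comm = λ x y → pointwise (x +ℝ y) (y +ℝ x) λ n → ℚ.+-comm (seq x n) (seq y n)
        }
      ; *-cong = λ {x} {y} {u} {v} → *-congℝ {x} {y} {u} {v}
      ; *-assoc = λ x y z → pointwise ((x *ℝ y) *ℝ z) (x *ℝ (y *ℝ z))
          λ n → ℚ.*-assoc (seq x n) (seq y n) (seq z n)
      ; *-identity = (λ x → pointwise (1ℝ *ℝ x) x λ n → ℚ.*-identityˡ (seq x n))
                   , (λ x → pointwise (x *ℝ 1ℝ) x λ n → ℚ.*-identityʳ (seq x n))
      ; distrib = (λ x y z → pointwise (x *ℝ (y +ℝ z)) (x *ℝ y +ℝ x *ℝ z)
                    λ n → ℚ.*-distribˡ-+ (seq x n) (seq y n) (seq z n))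
                , (λ x y z → pointwise ((y +ℝ z) *ℝ x) (y *ℝ x +ℝ z *ℝ x)
                    λ n → ℚ.*-distribʳ-+ (seq x n) (seq y n) (seq z n))
      }
    ; *-comm = λ x y → pointwise (x *ℝ y) (y *ℝ x) λ n → ℚ.*-comm (seq x n) (seq y n)
    }
  }

open Sum (CommutativeRing.+-rawMonoid ℝ-commutativeRing) public using (sum)

Matrix : ℕ → Set
Matrix n = Fin n → Fin n → ℝ

infixr 7 _*ᵥ_

_*ᵥ_ : ∀ {n} → Matrix n → Vector ℝ n → Vector ℝ n
(A *ᵥ v) i = sum λ j → A i j *ℝ v j

IsEigenvalue : ∀ {n} → Matrix n → ℝ → Set
IsEigenvalue {n} A θ = Σ[ v ∈ Vector ℝ n ]
  ((∃[ i ] v i # 0ℝ) × (∀ i → (A *ᵥ v) i ≃ θ *ℝ v i))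

HasExactlyDistinctEigenvalues : ∀ {n} → ℕ → Matrix n → Set
HasExactlyDistinctEigenvalues k A = Σ[ θ ∈ Vector ℝ k ]
  ( (∀ i j → i ≢ j → θ i # θ j)
  × (∀ i → IsEigenvalue A (θ i))
  × (∀ μ → IsEigenvalue A μ → ∃[ i ] μ ≃ θ i))

record Graph (n : ℕ) : Set where
  field
    adj       : Fin n → Fin n → Bool
    symmetric : ∀ u v → adj u v ≡ adj v u
    loopless  : ∀ v → adj v v ≡ false

  Adjacent : Fin n → Fin n → Set
  Adjacent u v = adj u v ≡ true

  neighbours : Fin n → Subset n
  neighbours v = tabulate (adj v)

  valency : Fin n → ℕ
  valency v = ∣ neighbours v ∣

  distinctValencies : List ℕ
  distinctValencies = deduplicate ℕ._≟_ (map valency (allFin n))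

  #valencies : ℕ
  #valencies = length distinctValencies

  Connected : Set
  Connected = 1 ℕ.≤ n × (∀ u v → Star Adjacent u v)

  adjacencyMatrix : Matrix n
  adjacencyMatrix u v = if adj u v then 1ℝ else 0ℝ

open Graph public using (#valencies; Connected; adjacencyMatrix)

ContainsInduced : ∀ {m n} → Graph m → Graph n → Set
ContainsInduced {m} {n} Γ Δ = Σ[ f ∈ (Fin n → Fin m) ]
  (Injective _≡_ _≡_ f × (∀ u v → Graph.adj Γ (f u) (f v) ≡ Graph.adj Δ u v))

module Submission where

-- A nondegenerate alternating form B on F₂²ʳ gives a symmetric matrix (-1)^B of
-- order N = 4ʳ with square N·I and diagonal 1. Switching it, H = D (-1)^B D with
-- D = ±1 diagonal, preserves these properties, and the graph Γ with adjacency
-- matrix A = (J - H) / 2 is determined by H. If A v = θ v then, with σ = Σ v and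
-- h = H 1, applying H to H v = σ 1 - 2 θ v gives (4θ² - N) v = σ (2θ 1 - h), so θ
-- is a root of (4θ² - N) q(θ), q(θ) = 4θ² - 2Nθ + Σ h - N. When Γ is not regular
-- all four roots are distinct and occur.
--
-- Every Δ on n vertices is the Gram matrix of distinct nonzero vectors w₁, …, wₙ
-- of F₂²ʳ with r = ⌊n/2⌋ + 1: split off a hyperbolic plane as long as there is an
-- edge, and use a totally isotropic subspace once there is none. Switching at
-- exactly these vectors keeps Δ as an induced subgraph and makes
-- h(wᵢ) = 2 (n - 2 deg i), so distinct valencies of Δ stay distinct in Γ.

open import Defs hiding (sum)
open import Algebra.Bundles using (CommutativeRing)
import Algebra.Properties.Semiring.Sum as SemiringSum
import Algebra.Solver.Ring as RingSolver
open import Algebra.Solver.Ring.AlmostCommutativeRing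
  using (fromCommutativeRing; _-Raw-AlmostCommutative⟶_; -raw-almostCommutative⟶)
open import Data.Bool.Base using (Bool; true; false; _∧_; _xor_; if_then_else_)
import Data.Bool.Properties as Bool
open import Data.Empty using (⊥)
open import Data.Fin.Base using (Fin; zero; suc; toℕ; combine; remQuot; inject≤; _↑ˡ_; _↑ʳ_)
open import Data.Fin.Patterns using (0F; 1F; 2F; 3F)
import Data.Fin.Properties as Fin
open import Data.Fin.Subset using (∣_∣)
open import Data.Integer.Base as ℤ using ()
import Data.Integer.Properties as ℤ
open import Data.List.Base as List using (List; []; _∷_; length; lookup; map; filter; foldr; allFin)
open import Data.List.Membership.DecPropositional using () renaming (_∈?_ to ∈?-by)
open import Data.List.Membership.Propositional using (_∈_; find; lose)
open import Data.List.Membership.Propositional.Properties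
  using (∈-allFin; ∈-lookup; ∈-filter⁺; ∈-map⁺; ∈-map⁻; ∈-deduplicate⁺; ∈-deduplicate⁻)
open import Data.List.Properties using (filter-notAll; length-tabulate)
open import Data.List.Relation.Unary.All as All using (_∷_)
open import Data.List.Relation.Unary.AllPairs using (AllPairs; _∷_)
import Data.List.Relation.Unary.AllPairs.Properties as AllPairs
open import Data.List.Relation.Unary.Any as Any using (Any; here; there)
import Data.List.Relation.Unary.Any.Properties as Any
open import Data.List.Relation.Unary.Unique.Propositional using (Unique)
open import Data.Maybe.Base using (Maybe; just; nothing)
open import Data.Nat.Base as ℕ using (ℕ; zero; suc; ⌊_/2⌋; ⌈_/2⌉; _^_; _<_; _≤_; s≤s; z≤n)
open import Data.Nat.DivMod using (_/_; _%_; _mod_; m≡m%n+[m/n]*n; m<n*o⇒m/o<n; m%n<n)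
import Data.Nat.Properties as ℕ
open import Data.List.Relation.Unary.Unique.DecPropositional.Properties ℕ._≟_ using (deduplicate-!)
open import Data.Product.Base using (_×_; _,_; ∃-syntax; Σ-syntax; proj₁; proj₂)
open import Data.Rational.Base as ℚ using (ℚ; mkℚ; 0ℚ; 1ℚ; ½; toℚᵘ)
import Data.Rational.Properties as ℚ
open import Data.Rational.Solver using (module +-*-Solver)
open import Data.Rational.Unnormalised.Base as ℚᵘ using (mkℚᵘ; *≡*; *≤*)
import Data.Rational.Unnormalised.Properties as ℚᵘ
open import Data.Sum.Base using (_⊎_; inj₁; inj₂; [_,_]′)
open import Data.Vec.Base as Vec using (_∷_)
open import Data.Vec.Functional using (Vector)
open import Function.Base using (_∘_)
open import Level using (0ℓ)
open import Relation.Binary.Construct.Closure.ReflexiveTransitive as Star using (Star; _◅_; _◅◅_)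
open import Relation.Binary.Definitions using (tri<; tri≈; tri>)
open import Relation.Binary.PropositionalEquality
  using (_≡_; _≢_; refl; sym; trans; cong; cong₂; subst; subst₂; module ≡-Reasoning)
open import Relation.Nullary using (Dec; yes; no; ¬_; ¬?; does; contradiction; _×-dec_)
open import Relation.Nullary.Decidable using (dec-true; dec-false)

-- Equality of Cauchy reals is not decidable, so distinct eigenvalues are apart ones and no step may
-- ask whether a real is 0. Two facts carry the argument instead: a factor of a nonzero rational is
-- apart from 0, and a factor apart from 0 cancels from a vanishing product. Irregularity enters
-- through one identity: for c² = N, Σ (h - c)² = 2c (Nc - Σ h), which is nonzero as soon as h is
-- not constant. With c = ±√N it keeps ±√N / 2 away from the roots of q, and it makes the
-- discriminant of q positive. Since N = 4ʳ is a rational square, only the roots of q call for a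
-- real square root. Each hyperbolic plane uses up two vertices, and at least one plane must be left
-- when the edges run out; hence 2r > n, and the least such r gives 4ʳ ≤ 2ⁿ⁺². The vectors avoid 0
-- because the unswitched row sums are N at 0 and vanish elsewhere. From t ≥ 3 come two different
-- valencies, hence irregularity, and n ≥ 3, hence 4n < N for connectedness and N ≠ 4 for the
-- eigenvalues ±√N / 2.

-- Apartness from zero for Cauchy reals.

<⇒≱ : ∀ {p q} → p ℚ.< q → q ℚ.≤ p → ⊥
<⇒≱ p<q q≤p = ℚ.<-irrefl refl (ℚ.<-≤-trans p<q q≤p)

p-0≡p : ∀ p → p ℚ.- 0ℚ ≡ p
p-0≡p = ℚ.+-identityʳ

far-from-0 : ∀ {ε} p q → Close (½ ℚ.* ε) p q → ε ℚ.≤ ℚ.∣ p ℚ.- 0ℚ ∣ → ½ ℚ.* ε ℚ.≤ ℚ.∣ q ℚ.- 0ℚ ∣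
far-from-0 p q p~q p-far =
  ℚ.≮⇒≥ λ q-near → <⇒≱ (close-trans p q 0ℚ p~q q-near) p-far

#0-resp-≃ : ∀ x y → x ≃ y → x # 0ℝ → y # 0ℝ
#0-resp-≃ x y x≃y (ε , 0<ε , M , x-far) =
  let N , x~y = x≃y (½ ℚ.* ε) (½-pos 0<ε) in
  ½ ℚ.* ε , ½-pos 0<ε , M ℕ.⊔ N , λ n h →
    far-from-0 (seq x n) (seq y n) (x~y n (⊔ʳ h)) (x-far n (⊔ˡ h))

-- Once `ε` is fixed, a single late term decides: all later terms lie within `ε`/4 of it, so if it
-- is at least `ε`/2 in size the number stays `ε`/4 away from 0, and otherwise all later terms are
-- below `ε`.
#0-or-small : ∀ x {ε} → 0ℚ ℚ.< ε → x # 0ℝ ⊎ Eventually λ n → Close ε (seq x n) 0ℚ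
#0-or-small x {ε} 0<ε with cauchy x (½ ℚ.* (½ ℚ.* ε)) (½-pos (½-pos 0<ε))
... | N , x~x with ℚ.∣ seq x N ℚ.- 0ℚ ∣ ℚ.<? ½ ℚ.* ε
...   | no  x-far = inj₁ (½ ℚ.* (½ ℚ.* ε) , ½-pos (½-pos 0<ε) , N , λ n h →
        far-from-0 (seq x N) (seq x n) (x~x N n ℕ.≤-refl h) (ℚ.≮⇒≥ x-far))
...   | yes x-near = inj₂ (N , λ n h →
        close-trans (seq x n) (seq x N) 0ℚ
          (ℚ.<-trans (x~x n N h ℕ.≤-refl) (half-< (½-pos 0<ε))) x-near)
  where
  half-< : ∀ {δ} → 0ℚ ℚ.< δ → ½ ℚ.* δ ℚ.< δ
  half-< {δ} 0<δ = begin-strict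
    ½ ℚ.* δ                 ≡⟨ ℚ.+-identityʳ (½ ℚ.* δ) ⟨
    ½ ℚ.* δ ℚ.+ 0ℚ          <⟨ ℚ.+-monoʳ-< (½ ℚ.* δ) (½-pos 0<δ) ⟩
    ½ ℚ.* δ ℚ.+ ½ ℚ.* δ     ≡⟨ halves δ ⟩
    δ                       ∎
    where open ℚ.≤-Reasoning

-- If `x` is not found apart from 0, it is eventually below half of the bound for the sum, which
-- leaves the other half to `y`.
#0-split : ∀ x y → (x +ℝ y) # 0ℝ → x # 0ℝ ⊎ y # 0ℝ
#0-split x y (ε , 0<ε , M , far) with #0-or-small x (½-pos 0<ε)
... | inj₁ x#0 = inj₁ x#0
... | inj₂ (N , near) = inj₂ (½ ℚ.* ε , ½-pos 0<ε , M ℕ.⊔ N , λ n h →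
  far-from-0 (seq x n ℚ.+ seq y n) (seq y n)
    (subst (ℚ._< ½ ℚ.* ε)
      (cong ℚ.∣_∣ (solve 2 (λ a b → a :- con 0ℚ := (a :+ b) :- b) refl (seq x n) (seq y n)))
      (near n (⊔ʳ h)))
    (far n (⊔ˡ h)))
  where open +-*-Solver

-- `y` is eventually below some `B`, so a term of `x` smaller than `ε`/`B` would push the product
-- below `ε`.
#0-*ˡ : ∀ x y → (x *ℝ y) # 0ℝ → x # 0ℝ
#0-*ˡ x y (ε , 0<ε , M , far) =
  let B , 0<B , N , y<B = bounded y
      δ , 0<δ , Bδ≡ε = scale 0<B 0<ε
  in δ , 0<δ , M ℕ.⊔ N , λ n h → ℚ.≮⇒≥ λ x<δ → <⇒≱ (begin-strict
    ℚ.∣ seq x n ℚ.* seq y n ℚ.- 0ℚ ∣  ≡⟨ cong ℚ.∣_∣ (p-0≡p (seq x n ℚ.* seq y n)) ⟩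
    ℚ.∣ seq x n ℚ.* seq y n ∣         ≡⟨ ℚ.∣p*q∣≡∣p∣*∣q∣ (seq x n) (seq y n) ⟩
    ℚ.∣ seq x n ∣ ℚ.* ℚ.∣ seq y n ∣   ≤⟨ ℚ.*-monoˡ-≤-nonNeg ℚ.∣ seq x n ∣ {{ℚ.∣-∣-nonNeg (seq x n)}} (ℚ.<⇒≤ (y<B n (⊔ʳ h))) ⟩
    ℚ.∣ seq x n ∣ ℚ.* B               <⟨ ℚ.*-monoˡ-<-pos B {{ℚ.positive 0<B}} (subst (ℚ._< δ) (cong ℚ.∣_∣ (p-0≡p (seq x n))) x<δ) ⟩
    δ ℚ.* B                           ≡⟨ ℚ.*-comm δ B ⟩
    B ℚ.* δ                           ≡⟨ Bδ≡ε ⟩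
    ε                                 ∎) (far n (⊔ˡ h))
  where open ℚ.≤-Reasoning

-- The terms of `x` are eventually at least `ε`, so those of `y` are at most those of the product
-- divided by `ε`; no inverse of `x` is constructed.
#0-cancel : ∀ x y → x # 0ℝ → (x *ℝ y) ≃ 0ℝ → y ≃ 0ℝ
#0-cancel x y (ε , 0<ε , M , far) xy≃0 η 0<η =
  let N , near = xy≃0 (ε ℚ.* η) 0<εη in
  M ℕ.⊔ N , λ n h → ℚ.*-cancelˡ-<-nonNeg ε {{ℚ.nonNegative (ℚ.<⇒≤ 0<ε)}} (begin-strict
    ε ℚ.* ℚ.∣ seq y n ℚ.- 0ℚ ∣          ≡⟨ cong (λ t → ε ℚ.* ℚ.∣ t ∣) (p-0≡p (seq y n)) ⟩
    ε ℚ.* ℚ.∣ seq y n ∣                 ≤⟨ ℚ.*-monoʳ-≤-nonNeg ℚ.∣ seq y n ∣ {{ℚ.∣-∣-nonNeg (seq y n)}} (far n (⊔ˡ h)) ⟩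
    ℚ.∣ seq x n ℚ.- 0ℚ ∣ ℚ.* ℚ.∣ seq y n ∣ ≡⟨ ℚ.∣p*q∣≡∣p∣*∣q∣ (seq x n ℚ.- 0ℚ) (seq y n) ⟨
    ℚ.∣ (seq x n ℚ.- 0ℚ) ℚ.* seq y n ∣  ≡⟨ cong ℚ.∣_∣ (solve 2 (λ a b → (a :- con 0ℚ) :* b := a :* b :- con 0ℚ) refl (seq x n) (seq y n)) ⟩
    ℚ.∣ seq x n ℚ.* seq y n ℚ.- 0ℚ ∣    <⟨ near n (⊔ʳ h) ⟩
    ε ℚ.* η                             ∎)
  where
  open +-*-Solver
  open ℚ.≤-Reasoning
  0<εη : 0ℚ ℚ.< ε ℚ.* η
  0<εη = ℚ.positive⁻¹ (ε ℚ.* η) {{ℚ.pos*pos⇒pos ε {{ℚ.positive 0<ε}} η {{ℚ.positive 0<η}}}}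

fromℚ-#0 : ∀ q → q ≢ 0ℚ → fromℚ q # 0ℝ
fromℚ-#0 q q≢0 = ℚ.∣ q ∣ , 0<∣q∣ , 0 , λ _ _ → ℚ.≤-reflexive (cong ℚ.∣_∣ (sym (p-0≡p q)))
  where
  0<∣q∣ : 0ℚ ℚ.< ℚ.∣ q ∣
  0<∣q∣ = ℚ.≰⇒> λ ∣q∣≤0 → q≢0 (ℚ.∣p∣≡0⇒p≡0 q (ℚ.≤-antisym ∣q∣≤0 (ℚ.0≤∣p∣ q)))

-#0⇒# : ∀ x y → (x +ℝ -ℝ y) # 0ℝ → x # y
-#0⇒# x y (ε , 0<ε , N , far) = ε , 0<ε , N , λ n h →
  subst (ε ℚ.≤_) (cong ℚ.∣_∣ (p-0≡p (seq x n ℚ.- seq y n))) (far n h)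

-- Rational square roots as reals, by bisection.

ν : ℕ → ℚ
ν zero    = 0ℚ
ν (suc n) = 1ℚ ℚ.+ ν n

0≤ν : ∀ n → 0ℚ ℚ.≤ ν n
0≤ν zero    = ℚ.≤-refl
0≤ν (suc n) = ℚ.≤-trans (0≤ν n) (subst (ℚ._≤ ν (suc n)) (ℚ.+-identityˡ (ν n))
  (ℚ.+-monoˡ-≤ (ν n) (ℚ.<⇒≤ (ℚ.positive⁻¹ 1ℚ))))

p<1+p : ∀ p → p ℚ.< 1ℚ ℚ.+ p
p<1+p p = subst (ℚ._< 1ℚ ℚ.+ p) (ℚ.+-identityˡ p) (ℚ.+-monoˡ-< p (ℚ.positive⁻¹ 1ℚ))

toℚᵘ-ν : ∀ n → toℚᵘ (ν n) ℚᵘ.≃ mkℚᵘ (ℤ.+ n) 0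
toℚᵘ-ν zero    = ℚᵘ.≃-refl
toℚᵘ-ν (suc n) = ℚᵘ.≃-trans (ℚ.toℚᵘ-homo-+ 1ℚ (ν n))
  (ℚᵘ.≃-trans (ℚᵘ.+-congʳ (toℚᵘ 1ℚ) (toℚᵘ-ν n))
    (*≡* (cong (λ k → (ℤ.+ 1 ℤ.+ k) ℤ.* ℤ.+ 1) (ℤ.*-identityʳ (ℤ.+ n)))))

archimedean : ∀ q → ∃[ n ] q ℚ.< ν n
archimedean q@(mkℚ ℤ.-[1+ _ ] _ _) = 0 , ℚ.negative⁻¹ q
archimedean q@(mkℚ (ℤ.+ a) d _) = suc a , ℚ.≤-<-trans q≤a (p<1+p (ν a))
  where
  q≤a : q ℚ.≤ ν a
  q≤a = ℚ.toℚᵘ-cancel-≤ (ℚᵘ.≤-respʳ-≃ (ℚᵘ.≃-sym (toℚᵘ-ν a))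
    (*≤* (ℤ.*-monoˡ-≤-nonNeg (ℤ.+ a) (ℤ.+≤+ (ℕ.s≤s ℕ.z≤n)))))

½≥0 : ∀ {p} → 0ℚ ℚ.≤ p → 0ℚ ℚ.≤ ½ ℚ.* p
½≥0 {p} 0≤p = subst (ℚ._≤ ½ ℚ.* p) (ℚ.*-zeroʳ ½) (ℚ.*-monoˡ-≤-nonNeg ½ 0≤p)

½≤ : ∀ {p} → 0ℚ ℚ.≤ p → ½ ℚ.* p ℚ.≤ p
½≤ {p} 0≤p = begin
  ½ ℚ.* p               ≡⟨ ℚ.+-identityʳ (½ ℚ.* p) ⟨
  ½ ℚ.* p ℚ.+ 0ℚ        ≤⟨ ℚ.+-monoʳ-≤ (½ ℚ.* p) (½≥0 0≤p) ⟩
  ½ ℚ.* p ℚ.+ ½ ℚ.* p   ≡⟨ halves p ⟩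
  p                     ∎
  where open ℚ.≤-Reasoning

halve : ℕ → ℚ → ℚ
halve zero    w = w
halve (suc k) w = ½ ℚ.* halve k w

module _ {w : ℚ} (0≤w : 0ℚ ℚ.≤ w) where

  0≤halve : ∀ k → 0ℚ ℚ.≤ halve k w
  0≤halve zero    = 0≤w
  0≤halve (suc k) = ½≥0 (0≤halve k)

  halve≤ : ∀ k → halve k w ℚ.≤ w
  halve≤ zero    = ℚ.≤-refl
  halve≤ (suc k) = ℚ.≤-trans (½≤ (0≤halve k)) (halve≤ k)

  -- This is k / 2ᵏ ≤ 1; with the Archimedean property it brings repeated halves of `w` below any
  -- positive bound.
  ν*halve≤ : ∀ k → ν k ℚ.* halve k w ℚ.≤ w
  ν*halve≤ zero    = subst (ℚ._≤ w) (sym (ℚ.*-zeroˡ w)) 0≤w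
  ν*halve≤ (suc k) = begin
    (1ℚ ℚ.+ ν k) ℚ.* (½ ℚ.* x)         ≡⟨ solve 2 (λ n x → (con 1ℚ :+ n) :* (con ½ :* x) := con ½ :* x :+ con ½ :* (n :* x)) refl (ν k) x ⟩
    ½ ℚ.* x ℚ.+ ½ ℚ.* (ν k ℚ.* x)      ≤⟨ ℚ.+-mono-≤ (ℚ.*-monoˡ-≤-nonNeg ½ (halve≤ k)) (ℚ.*-monoˡ-≤-nonNeg ½ (ν*halve≤ k)) ⟩
    ½ ℚ.* w ℚ.+ ½ ℚ.* w                ≡⟨ halves w ⟩
    w                                  ∎
    where
    open +-*-Solver
    open ℚ.≤-Reasoning
    x : ℚ
    x = halve k w

  halve-small : ∀ {ε} → 0ℚ ℚ.< ε → ∃[ k ] halve k w ℚ.< ε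
  halve-small {ε} 0<ε =
    let δ , _ , εδ≡1+w = scale 0<ε (ℚ.≤-<-trans 0≤w (p<1+p w))
        k , δ<k = archimedean δ
    in k , ℚ.*-cancelˡ-<-nonNeg (ν k) {{ℚ.nonNegative (0≤ν k)}} (begin-strict
      ν k ℚ.* halve k w   ≤⟨ ν*halve≤ k ⟩
      w                   <⟨ p<1+p w ⟩
      1ℚ ℚ.+ w            ≡⟨ εδ≡1+w ⟨
      ε ℚ.* δ             <⟨ ℚ.*-monoʳ-<-pos ε {{ℚ.positive 0<ε}} δ<k ⟩
      ε ℚ.* ν k           ≡⟨ ℚ.*-comm ε (ν k) ⟩
      ν k ℚ.* ε           ∎)
    where open ℚ.≤-Reasoning

∣∣<⁺ : ∀ {p ε} → p ℚ.< ε → ℚ.- p ℚ.< ε → ℚ.∣ p ∣ ℚ.< ε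
∣∣<⁺ {p} {ε} p<ε -p<ε with ℚ.∣p∣≡p∨∣p∣≡-p p
... | inj₁ eq = subst (ℚ._< ε) (sym eq) p<ε
... | inj₂ eq = subst (ℚ._< ε) (sym eq) -p<ε

-‿mono-≤ : ∀ {a b c d} → a ℚ.≤ b → c ℚ.≤ d → a ℚ.- d ℚ.≤ b ℚ.- c
-‿mono-≤ a≤b c≤d = ℚ.+-mono-≤ a≤b (ℚ.neg-antimono-≤ c≤d)

*-mono-≤ : ∀ {a b c d} → 0ℚ ℚ.≤ a → 0ℚ ℚ.≤ d → a ℚ.≤ b → c ℚ.≤ d → a ℚ.* c ℚ.≤ b ℚ.* d
*-mono-≤ {a} {b} {c} {d} 0≤a 0≤d a≤b c≤d = ℚ.≤-trans
  (ℚ.*-monoˡ-≤-nonNeg a {{ℚ.nonNegative 0≤a}} c≤d)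
  (ℚ.*-monoʳ-≤-nonNeg d {{ℚ.nonNegative 0≤d}} a≤b)

module SquareRoot {D : ℚ} (0≤D : 0ℚ ℚ.≤ D) where

  record Bracket : Set where
    field
      lo hi  : ℚ
      0≤lo   : 0ℚ ℚ.≤ lo
      lo≤hi  : lo ℚ.≤ hi
      lo²≤D  : lo ℚ.* lo ℚ.≤ D
      D≤hi²  : D ℚ.≤ hi ℚ.* hi

  open Bracket

  width : Bracket → ℚ
  width b = hi b ℚ.- lo b

  mid : Bracket → ℚ
  mid b = ½ ℚ.* (lo b ℚ.+ hi b)

  lo≤mid : ∀ b → lo b ℚ.≤ mid b
  lo≤mid b = subst₂ ℚ._≤_ (halves (lo b)) (sym (ℚ.*-distribˡ-+ ½ (lo b) (hi b)))
    (ℚ.+-monoʳ-≤ (½ ℚ.* lo b) (ℚ.*-monoˡ-≤-nonNeg ½ (lo≤hi b)))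

  mid≤hi : ∀ b → mid b ℚ.≤ hi b
  mid≤hi b = subst₂ ℚ._≤_ (sym (ℚ.*-distribˡ-+ ½ (lo b) (hi b))) (halves (hi b))
    (ℚ.+-monoˡ-≤ (½ ℚ.* hi b) (ℚ.*-monoˡ-≤-nonNeg ½ (lo≤hi b)))

  record Halving (b : Bracket) : Set where
    field
      next   : Bracket
      lo↑    : lo b ℚ.≤ lo next
      hi↓    : hi next ℚ.≤ hi b
      width½ : width next ≡ ½ ℚ.* width b

  open Halving

  -- The test compares rationals and is therefore decidable; the real root itself is never compared
  -- with anything.
  bisect : ∀ b → Halving b
  bisect b with mid b ℚ.* mid b ℚ.≤? D
  ... | yes mid²≤D = record
    { next   = record b { lo = mid b ; 0≤lo = ℚ.≤-trans (0≤lo b) (lo≤mid b)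
                        ; lo≤hi = mid≤hi b ; lo²≤D = mid²≤D }
    ; lo↑    = lo≤mid b
    ; hi↓    = ℚ.≤-refl
    ; width½ = solve 2 (λ l h → h :- con ½ :* (l :+ h) := con ½ :* (h :- l)) refl (lo b) (hi b)
    }
    where open +-*-Solver
  ... | no mid²≰D = record
    { next   = record b { hi = mid b ; lo≤hi = lo≤mid b ; D≤hi² = ℚ.<⇒≤ (ℚ.≰⇒> mid²≰D) }
    ; lo↑    = ℚ.≤-refl
    ; hi↓    = mid≤hi b
    ; width½ = solve 2 (λ l h → con ½ :* (l :+ h) :- l := con ½ :* (h :- l)) refl (lo b) (hi b)
    }
    where open +-*-Solver

  initial : Bracket
  initial = record
    { lo = 0ℚ ; hi = 1ℚ ℚ.+ D ; 0≤lo = ℚ.≤-refl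
    ; lo≤hi = 0≤1+D
    ; lo²≤D = 0≤D
    ; D≤hi² = ℚ.≤-trans (ℚ.<⇒≤ (p<1+p D)) (subst (ℚ._≤ (1ℚ ℚ.+ D) ℚ.* (1ℚ ℚ.+ D)) (ℚ.*-identityˡ (1ℚ ℚ.+ D))
        (ℚ.*-monoʳ-≤-nonNeg (1ℚ ℚ.+ D) {{ℚ.nonNegative 0≤1+D}}
          (subst (ℚ._≤ 1ℚ ℚ.+ D) (ℚ.+-identityʳ 1ℚ) (ℚ.+-monoʳ-≤ 1ℚ 0≤D))))
    }
    where
    0≤1+D : 0ℚ ℚ.≤ 1ℚ ℚ.+ D
    0≤1+D = ℚ.≤-trans 0≤D (ℚ.<⇒≤ (p<1+p D))

  bracket : ℕ → Bracket
  bracket zero    = initial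
  bracket (suc k) = next (bisect (bracket k))

  lo-mono′ : ∀ k d → lo (bracket k) ℚ.≤ lo (bracket (d ℕ.+ k))
  lo-mono′ k zero    = ℚ.≤-refl
  lo-mono′ k (suc d) = ℚ.≤-trans (lo-mono′ k d) (lo↑ (bisect (bracket (d ℕ.+ k))))

  lo-mono : ∀ {k n} → k ℕ.≤ n → lo (bracket k) ℚ.≤ lo (bracket n)
  lo-mono {k} {n} k≤n = subst (λ n → lo (bracket k) ℚ.≤ lo (bracket n)) (ℕ.m∸n+n≡m k≤n) (lo-mono′ k (n ℕ.∸ k))

  hi-mono′ : ∀ k d → hi (bracket (d ℕ.+ k)) ℚ.≤ hi (bracket k)
  hi-mono′ k zero    = ℚ.≤-refl
  hi-mono′ k (suc d) = ℚ.≤-trans (hi↓ (bisect (bracket (d ℕ.+ k)))) (hi-mono′ k d)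

  hi-mono : ∀ {k n} → k ℕ.≤ n → hi (bracket n) ℚ.≤ hi (bracket k)
  hi-mono {k} {n} k≤n = subst (λ n → hi (bracket n) ℚ.≤ hi (bracket k)) (ℕ.m∸n+n≡m k≤n) (hi-mono′ k (n ℕ.∸ k))

  width-halve : ∀ k → width (bracket k) ≡ halve k (width initial)
  width-halve zero    = refl
  width-halve (suc k) = trans (width½ (bisect (bracket k))) (cong (½ ℚ.*_) (width-halve k))

  0≤width : ∀ b → 0ℚ ℚ.≤ width b
  0≤width b = subst (ℚ._≤ width b) (ℚ.+-inverseʳ (lo b)) (ℚ.+-monoˡ-≤ (ℚ.- lo b) (lo≤hi b))

  lo≤hi-late : ∀ {k n} → k ℕ.≤ n → lo (bracket n) ℚ.≤ hi (bracket k)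
  lo≤hi-late {k} {n} k≤n = ℚ.≤-trans (lo≤hi (bracket n)) (hi-mono k≤n)

  -- From stage `k` on, every lower end lies between the two ends of `bracket k`, so two of them
  -- differ by at most its width.
  lo-cauchy : IsCauchy (λ n → lo (bracket n))
  lo-cauchy ε 0<ε with halve-small (0≤width initial) 0<ε
  ... | k , small = k , λ m n k≤m k≤n → ∣∣<⁺ (gap m n k≤m k≤n)
    (subst (ℚ._< ε) (solve 2 (λ a b → b :- a := :- (a :- b)) refl (lo (bracket m)) (lo (bracket n))) (gap n m k≤n k≤m))
    where
    open +-*-Solver
    gap : ∀ m n → k ℕ.≤ m → k ℕ.≤ n → lo (bracket m) ℚ.- lo (bracket n) ℚ.< ε
    gap m n k≤m k≤n = ℚ.≤-<-trans (-‿mono-≤ (lo≤hi-late k≤m) (lo-mono k≤n))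
      (subst (ℚ._< ε) (sym (width-halve k)) small)

  √ : ℝ
  √ = mkℝ (λ n → lo (bracket n)) lo-cauchy

  -- `D` lies between lo² and hi², whose difference (hi + lo)(hi - lo) is at most `C` times the
  -- width; `C` is twice the initial upper end, which bounds every later end.
  √*√≃D : (√ *ℝ √) ≃ fromℚ D
  √*√≃D ε 0<ε =
    let δ , 0<δ , Cδ≡ε = scale (ℚ.+-mono-< 0<hi 0<hi) 0<ε
        k , small = halve-small (0≤width initial) 0<δ
    in k , λ n k≤n → ∣∣<⁺ (below n) (above n k≤n Cδ≡ε small)
    where
    open +-*-Solver
    0<hi : 0ℚ ℚ.< hi initial
    0<hi = ℚ.≤-<-trans 0≤D (p<1+p D)
    C : ℚ
    C = hi initial ℚ.+ hi initial
    below : ∀ n → lo (bracket n) ℚ.* lo (bracket n) ℚ.- D ℚ.< ε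
    below n = ℚ.≤-<-trans (subst (lo (bracket n) ℚ.* lo (bracket n) ℚ.- D ℚ.≤_) (ℚ.+-inverseʳ D)
      (ℚ.+-monoˡ-≤ (ℚ.- D) (lo²≤D (bracket n)))) 0<ε
    above : ∀ {δ k} n → k ℕ.≤ n → C ℚ.* δ ≡ ε → halve k (width initial) ℚ.< δ →
            ℚ.- (lo (bracket n) ℚ.* lo (bracket n) ℚ.- D) ℚ.< ε
    above {δ} {k} n k≤n Cδ≡ε small = begin-strict
      ℚ.- (l ℚ.* l ℚ.- D)        ≡⟨ solve 2 (λ a b → :- (a :- b) := b :- a) refl (l ℚ.* l) D ⟩
      D ℚ.- l ℚ.* l              ≤⟨ ℚ.+-monoˡ-≤ (ℚ.- (l ℚ.* l)) (D≤hi² (bracket n)) ⟩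
      h ℚ.* h ℚ.- l ℚ.* l        ≡⟨ solve 2 (λ h l → h :* h :- l :* l := (h :+ l) :* (h :- l)) refl h l ⟩
      (h ℚ.+ l) ℚ.* (h ℚ.- l)    ≤⟨ *-mono-≤ 0≤h+l (0≤width (bracket k)) (ℚ.+-mono-≤ h≤ (ℚ.≤-trans (lo≤hi (bracket n)) h≤))
                                      (-‿mono-≤ (hi-mono k≤n) (lo-mono k≤n)) ⟩
      C ℚ.* width (bracket k)    <⟨ ℚ.*-monoʳ-<-pos C {{ℚ.positive (ℚ.+-mono-< 0<hi 0<hi)}}
                                      (subst (ℚ._< δ) (sym (width-halve k)) small) ⟩
      C ℚ.* δ                    ≡⟨ Cδ≡ε ⟩
      ε                          ∎
      where
      open ℚ.≤-Reasoning
      l h : ℚ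
      l = lo (bracket n)
      h = hi (bracket n)
      h≤ : h ℚ.≤ hi initial
      h≤ = hi-mono {zero} {n} ℕ.z≤n
      0≤h+l : 0ℚ ℚ.≤ h ℚ.+ l
      0≤h+l = ℚ.+-mono-≤ (ℚ.≤-trans (0≤lo (bracket n)) (lo≤hi (bracket n))) (0≤lo (bracket n))

-- Linear algebra of a symmetric matrix with square N·I.

δ : ∀ {n} → Fin n → Fin n → ℚ
δ i j = if does (i Fin.≟ j) then 1ℚ else 0ℚ

module ℚSum = SemiringSum (CommutativeRing.semiring ℚ.+-*-commutativeRing)

-- Used at ℝ and at ℚ; over an abstract R the ring solver never unfolds Cauchy sequences.
module RationalAlgebra (R : CommutativeRing 0ℓ 0ℓ)
  (morphism : CommutativeRing.rawRing ℚ.+-*-commutativeRing -Raw-AlmostCommutative⟶ fromCommutativeRing R)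
  where

  open CommutativeRing R hiding (zero) renaming (refl to ≈-refl; sym to ≈-sym; trans to ≈-trans)
  open _-Raw-AlmostCommutative⟶_ morphism public renaming (⟦_⟧ to ι)
  open SemiringSum semiring public
  open import Relation.Binary.Reasoning.Setoid setoid

  ι-cong : ∀ {p q} → p ≡ q → ι p ≈ ι q
  ι-cong p≡q = reflexive (cong ι p≡q)

  private
    ι≟ : ∀ p q → Maybe (ι p ≈ ι q)
    ι≟ p q with p ℚ.≟ q
    ... | yes p≡q = just (ι-cong p≡q)
    ... | no  _   = nothing

  module Solver = RingSolver (CommutativeRing.rawRing ℚ.+-*-commutativeRing) (fromCommutativeRing R) morphism ι≟

  sum-cong : ∀ {n} {u v : Vector Carrier n} → (∀ i → u i ≈ v i) → sum u ≈ sum v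
  sum-cong = sum-cong-≋

  ι-sum : ∀ {n} (u : Vector ℚ n) → ι (ℚSum.sum u) ≈ sum (λ i → ι (u i))
  ι-sum {zero}  u = 0-homo
  ι-sum {suc n} u = ≈-trans (+-homo (u zero) _) (+-congˡ (ι-sum (λ i → u (suc i))))

  sum-δ : ∀ {n} (i : Fin n) (v : Vector Carrier n) → sum (λ k → ι (δ i k) * v k) ≈ v i
  sum-δ {suc n} zero v = begin
    ι 1ℚ * v zero + sum (λ k → ι 0ℚ * v (suc k))  ≈⟨ +-cong (≈-trans (*-congʳ 1-homo) (*-identityˡ _)) (sum-cong {n} λ k → ≈-trans (*-congʳ 0-homo) (zeroˡ (v (suc k)))) ⟩
    v zero + sum {n} (λ k → 0#)                   ≈⟨ +-congˡ (sum-replicate-zero n) ⟩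
    v zero + 0#                                   ≈⟨ +-identityʳ _ ⟩
    v zero                                        ∎
  sum-δ {suc n} (suc i) v = begin
    ι 0ℚ * v zero + sum (λ k → ι (δ i k) * v (suc k))  ≈⟨ +-cong (≈-trans (*-congʳ 0-homo) (zeroˡ _)) (sum-δ i (λ k → v (suc k))) ⟩
    0# + v (suc i)                                     ≈⟨ +-identityˡ _ ⟩
    v (suc i)                                          ∎

  sum-linear : ∀ {n} a b (u v : Vector Carrier n) →
               sum (λ i → a * u i + b * v i) ≈ a * sum u + b * sum v
  sum-linear a b u v = begin
    sum (λ i → a * u i + b * v i)              ≈⟨ ∑-distrib-+ (λ i → a * u i) (λ i → b * v i) ⟩
    sum (λ i → a * u i) + sum (λ i → b * v i)  ≈⟨ +-cong (*-distribˡ-sum a u) (*-distribˡ-sum b v) ⟨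
    a * sum u + b * sum v                      ∎

  infixr 7 _·_
  _·_ : ∀ {m n} → (Fin m → Fin n → ℚ) → Vector Carrier n → Vector Carrier m
  (M · v) i = sum (λ j → ι (M i j) * v j)

  ·-cong : ∀ {m n} (M : Fin m → Fin n → ℚ) {u v} → (∀ i → u i ≈ v i) → ∀ i → (M · u) i ≈ (M · v) i
  ·-cong {n = n} M u≈v i = sum-cong {n} λ j → *-congˡ (u≈v j)

  ·-linear : ∀ {m n} (M : Fin m → Fin n → ℚ) a b u v i →
             (M · λ j → a * u j + b * v j) i ≈ a * (M · u) i + b * (M · v) i
  ·-linear {n = n} M a b u v i = begin
    sum (λ j → ι (M i j) * (a * u j + b * v j))
      ≈⟨ sum-cong {n} (λ j → solve 5 (λ m a b u v → m :* (a :* u :+ b :* v) := a :* (m :* u) :+ b :* (m :* v)) ≈-refl (ι (M i j)) a b (u j) (v j)) ⟩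
    sum (λ j → a * (ι (M i j) * u j) + b * (ι (M i j) * v j))
      ≈⟨ sum-linear {n} a b _ _ ⟩
    a * (M · u) i + b * (M · v) i ∎
    where open Solver

  module Hadamard {n} (H : Fin n → Fin n → ℚ) (N : ℚ)
    (n≡N : ℚSum.sum {n} (λ _ → 1ℚ) ≡ N)
    (H-sym : ∀ i j → H i j ≡ H j i)
    (H-orth : ∀ i j → ℚSum.sum (λ k → H i k ℚ.* H k j) ≡ N ℚ.* δ i j)
    where

    h : Vector ℚ n
    h i = ℚSum.sum (H i)

    e : ℚ
    e = ℚSum.sum h

    sum-1 : sum {n} (λ _ → 1#) ≈ ι N
    sum-1 = ≈-trans (sum-cong {n} (λ _ → ≈-sym 1-homo)) (≈-trans (≈-sym (ι-sum {n} (λ _ → 1ℚ))) (ι-cong n≡N))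

    H·1 : ∀ i → (H · λ _ → 1#) i ≈ ι (h i)
    H·1 i = ≈-trans (sum-cong {n} (λ j → *-identityʳ _)) (≈-sym (ι-sum {n} (H i)))

    H·H· : ∀ v i → (H · H · v) i ≈ ι N * v i
    H·H· v i = begin
      sum (λ j → ι (H i j) * sum (λ k → ι (H j k) * v k))
        ≈⟨ sum-cong {n} (λ j → *-distribˡ-sum {n} (ι (H i j)) _) ⟩
      sum (λ j → sum (λ k → ι (H i j) * (ι (H j k) * v k)))
        ≈⟨ ∑-comm {n} {n} _ ⟩
      sum (λ k → sum (λ j → ι (H i j) * (ι (H j k) * v k)))
        ≈⟨ sum-cong {n} (λ k → sum-cong {n} (λ j → ≈-trans (≈-sym (*-assoc _ _ _)) (*-congʳ (≈-sym (*-homo _ _))))) ⟩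
      sum (λ k → sum (λ j → ι (H i j ℚ.* H j k) * v k))
        ≈⟨ sum-cong {n} (λ k → *-distribʳ-sum {n} (v k) _) ⟨
      sum (λ k → sum (λ j → ι (H i j ℚ.* H j k)) * v k)
        ≈⟨ sum-cong {n} (λ k → *-congʳ (≈-trans (≈-sym (ι-sum {n} (λ j → H i j ℚ.* H j k))) (≈-trans (ι-cong (H-orth i k)) (*-homo N (δ i k))))) ⟩
      sum (λ k → ι N * ι (δ i k) * v k)
        ≈⟨ sum-cong {n} (λ k → *-assoc _ _ _) ⟩
      sum (λ k → ι N * (ι (δ i k) * v k))
        ≈⟨ *-distribˡ-sum {n} (ι N) _ ⟨
      ι N * sum (λ k → ι (δ i k) * v k)
        ≈⟨ *-congˡ (sum-δ i v) ⟩
      ι N * v i ∎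

    sum-H· : ∀ v → sum (H · v) ≈ sum (λ j → ι (h j) * v j)
    sum-H· v = begin
      sum (λ i → sum (λ j → ι (H i j) * v j))  ≈⟨ ∑-comm {n} {n} _ ⟩
      sum (λ j → sum (λ i → ι (H i j) * v j))  ≈⟨ sum-cong {n} (λ j → *-distribʳ-sum {n} (v j) _) ⟨
      sum (λ j → sum (λ i → ι (H i j)) * v j)  ≈⟨ sum-cong {n} (λ j → *-congʳ (≈-trans (sum-cong {n} (λ i → ι-cong (H-sym i j))) (≈-sym (ι-sum {n} (H j))))) ⟩
      sum (λ j → ι (h j) * v j)                ∎

    -- Because h = H 1, this is H² 1. The span of 1 and h is therefore invariant under `H`, and also
    -- under J.
    H·h : ∀ i → (H · λ j → ι (h j)) i ≈ ι N
    H·h i = begin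
      (H · λ j → ι (h j)) i     ≈⟨ ·-cong H H·1 i ⟨
      (H · H · λ _ → 1#) i      ≈⟨ H·H· (λ _ → 1#) i ⟩
      ι N * 1#                  ≈⟨ *-identityʳ _ ⟩
      ι N                       ∎

    module Adjacency (A : Fin n → Fin n → Carrier)
      (A≈ : ∀ i j → A i j ≈ ι (½ ℚ.* (1ℚ ℚ.- H i j))) where

      A·_ : Vector Carrier n → Vector Carrier n
      (A· v) i = sum (λ j → A i j * v j)

      A·≈ : ∀ v i → (A· v) i ≈ ι ½ * (sum v + - (H · v) i)
      A·≈ v i = begin
        sum (λ j → A i j * v j)
          ≈⟨ sum-cong {n} (λ j → ≈-trans (*-congʳ (≈-trans (A≈ i j) (≈-trans (*-homo ½ (1ℚ ℚ.- H i j)) (*-congˡ (≈-trans (+-homo 1ℚ (ℚ.- H i j)) (+-congˡ (-‿homo _)))))))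
             (solve 3 (λ a x v → a :* (con 1ℚ :- x) :* v := a :* v :+ (:- a) :* (x :* v)) ≈-refl (ι ½) (ι (H i j)) (v j))) ⟩
        sum (λ j → ι ½ * v j + (- ι ½) * (ι (H i j) * v j))
          ≈⟨ sum-linear {n} (ι ½) (- ι ½) v _ ⟩
        ι ½ * sum v + (- ι ½) * (H · v) i
          ≈⟨ solve 3 (λ a x y → a :* x :+ (:- a) :* y := a :* (x :- y)) ≈-refl (ι ½) (sum v) ((H · v) i) ⟩
        ι ½ * (sum v + - (H · v) i) ∎
        where open Solver

      2ℚ -1ℚ : ℚ
      2ℚ = 1ℚ ℚ.+ 1ℚ
      -1ℚ = ℚ.- 1ℚ

      -- The characteristic polynomial of J - H on the invariant plane spanned by 1 and h, at 2θ.
      q : Carrier → Carrier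
      q θ = (ι 2ℚ * θ) * (ι 2ℚ * θ) + - (ι N * (ι 2ℚ * θ)) + (ι e + - ι N)

      private
        quadratic : ∀ {k} → Solver.Polynomial k → Solver.Polynomial k → Solver.Polynomial k → Solver.Polynomial k
        quadratic t N e = (con 2ℚ :* t) :* (con 2ℚ :* t) :- N :* (con 2ℚ :* t) :+ (e :- N)
          where open Solver

      -- Summing (4θ² - N) v = σ (2θ 1 - h) over all coordinates gives q(θ) σ = 0. Multiplying the
      -- unsummed identity by q(θ) then kills its right side, with no case distinction on whether σ
      -- vanishes.
      eigenvalue-annihilates : ∀ θ v → (∀ i → (A· v) i ≈ θ * v i) → ∀ i →
                               q θ * ((ι 2ℚ * θ) * (ι 2ℚ * θ) + - ι N) * v i ≈ 0#
      eigenvalue-annihilates θ v Av≈θv i = begin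
        q θ * ((ι 2ℚ * θ) * (ι 2ℚ * θ) + - ι N) * v i
          ≈⟨ solve 4 (λ θ N e v → quadratic θ N e :* ((con 2ℚ :* θ) :* (con 2ℚ :* θ) :- N) :* v
                               := quadratic θ N e :* ((con 2ℚ :* θ) :* (con 2ℚ :* θ) :* v :- N :* v))
               ≈-refl θ (ι N) (ι e) (v i) ⟩
        q θ * ((ι 2ℚ * θ) * (ι 2ℚ * θ) * v i + - (ι N * v i))
          ≈⟨ *-congˡ (+-congˡ (-‿cong (≈-trans (N*v i) (+-congˡ (*-congˡ (H·v i)))))) ⟩
        q θ * ((ι 2ℚ * θ) * (ι 2ℚ * θ) * v i + - (σ * ι (h i) + (- (ι 2ℚ * θ)) * (σ * 1# + (- (ι 2ℚ * θ)) * v i)))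
          ≈⟨ *-congˡ (+-congˡ (-‿cong (+-congˡ (*-congˡ (+-congʳ (*-identityʳ σ)))))) ⟩
        q θ * ((ι 2ℚ * θ) * (ι 2ℚ * θ) * v i + - (σ * ι (h i) + (- (ι 2ℚ * θ)) * (σ + (- (ι 2ℚ * θ)) * v i)))
          -- The factor 2θ - h is pulled out, leaving q(θ) σ. Its term `N :* σ` stays separate so
          -- that the summed relation `N*σ` can be substituted for it.
          ≈⟨ solve 6 (λ θ N e v σ h →
                 quadratic θ N e :* ((con 2ℚ :* θ) :* (con 2ℚ :* θ) :* v :- (σ :* h :+ (:- (con 2ℚ :* θ)) :* (σ :+ (:- (con 2ℚ :* θ)) :* v)))
              := (con 2ℚ :* θ :- h) :* (((con 2ℚ :* θ) :* (con 2ℚ :* θ) :- N :* (con 2ℚ :* θ) :+ e) :* σ :- N :* σ))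
               ≈-refl θ (ι N) (ι e) (v i) σ (ι (h i)) ⟩
        (ι 2ℚ * θ + - ι (h i)) * (((ι 2ℚ * θ) * (ι 2ℚ * θ) + - (ι N * (ι 2ℚ * θ)) + ι e) * σ + - (ι N * σ))
          ≈⟨ *-congˡ (+-congˡ (-‿cong N*σ)) ⟩
        (ι 2ℚ * θ + - ι (h i)) * (((ι 2ℚ * θ) * (ι 2ℚ * θ) + - (ι N * (ι 2ℚ * θ)) + ι e) * σ + - (σ * ι e + (- (ι 2ℚ * θ)) * (σ * ι N + (- (ι 2ℚ * θ)) * σ)))
          ≈⟨ solve 5 (λ θ N e σ h →
                 (con 2ℚ :* θ :- h) :* (((con 2ℚ :* θ) :* (con 2ℚ :* θ) :- N :* (con 2ℚ :* θ) :+ e) :* σ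
                   :- (σ :* e :+ (:- (con 2ℚ :* θ)) :* (σ :* N :+ (:- (con 2ℚ :* θ)) :* σ)))
              := con 0ℚ)
               ≈-refl θ (ι N) (ι e) σ (ι (h i)) ⟩
        ι 0ℚ
          ≈⟨ 0-homo ⟩
        0# ∎
        where
        open Solver
        σ : Carrier
        σ = sum v
        H·v : ∀ i → (H · v) i ≈ σ * 1# + (- (ι 2ℚ * θ)) * v i
        H·v i = begin
          (H · v) i
            ≈⟨ solve 2 (λ σ x → x := σ :- con 2ℚ :* (con ½ :* (σ :- x))) ≈-refl σ ((H · v) i) ⟩
          σ + - (ι 2ℚ * (ι ½ * (σ + - (H · v) i)))
            ≈⟨ +-congˡ (-‿cong (*-congˡ (≈-trans (≈-sym (A·≈ v i)) (Av≈θv i)))) ⟩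
          σ + - (ι 2ℚ * (θ * v i))
            ≈⟨ +-cong (≈-sym (*-identityʳ σ)) (solve 2 (λ θ v → :- (con 2ℚ :* (θ :* v)) := (:- (con 2ℚ :* θ)) :* v) ≈-refl θ (v i)) ⟩
          σ * 1# + (- (ι 2ℚ * θ)) * v i ∎
        N*v : ∀ i → ι N * v i ≈ σ * ι (h i) + (- (ι 2ℚ * θ)) * (H · v) i
        N*v i = begin
          ι N * v i
            ≈⟨ H·H· v i ⟨
          (H · H · v) i
            ≈⟨ ·-cong H H·v i ⟩
          (H · λ j → σ * 1# + (- (ι 2ℚ * θ)) * v j) i
            ≈⟨ ·-linear H σ (- (ι 2ℚ * θ)) (λ _ → 1#) v i ⟩
          σ * (H · λ _ → 1#) i + (- (ι 2ℚ * θ)) * (H · v) i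
            ≈⟨ +-congʳ (*-congˡ (H·1 i)) ⟩
          σ * ι (h i) + (- (ι 2ℚ * θ)) * (H · v) i ∎
        N*σ : ι N * σ ≈ σ * ι e + (- (ι 2ℚ * θ)) * (σ * ι N + (- (ι 2ℚ * θ)) * σ)
        N*σ = begin
          ι N * sum v
            ≈⟨ *-distribˡ-sum (ι N) v ⟩
          sum (λ i → ι N * v i)
            ≈⟨ sum-cong {n} N*v ⟩
          sum (λ i → σ * ι (h i) + (- (ι 2ℚ * θ)) * (H · v) i)
            ≈⟨ sum-linear {n} σ (- (ι 2ℚ * θ)) _ _ ⟩
          σ * sum (λ i → ι (h i)) + (- (ι 2ℚ * θ)) * sum (H · v)
            ≈⟨ +-cong (*-congˡ (≈-sym (ι-sum h))) (*-congˡ (≈-trans (sum-cong {n} H·v)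
                 (≈-trans (sum-linear {n} σ (- (ι 2ℚ * θ)) (λ _ → 1#) v) (+-congʳ (*-congˡ sum-1))))) ⟩
          σ * ι e + (- (ι 2ℚ * θ)) * (σ * ι N + (- (ι 2ℚ * θ)) * σ) ∎

      -- The vector 2θ 1 - h on the right of (4θ² - N) v = σ (2θ 1 - h): up to scaling, the only
      -- candidate when 4θ² - N is invertible.
      mainVector : Carrier → Vector Carrier n
      mainVector θ i = ι 2ℚ * θ * 1# + ι -1ℚ * ι (h i)

      -- For arbitrary θ the vector fails to be an eigenvector by exactly -½ q(θ) 1.
      mainVector-eigen : ∀ θ → q θ ≈ 0# → ∀ i → (A· mainVector θ) i ≈ θ * mainVector θ i
      mainVector-eigen θ qθ≈0 i = begin
        (A· mainVector θ) i
          ≈⟨ A·≈ (mainVector θ) i ⟩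
        ι ½ * (sum (mainVector θ) + - (H · mainVector θ) i)
          ≈⟨ *-congˡ (+-cong
               (≈-trans (sum-linear {n} (ι 2ℚ * θ) (ι -1ℚ) (λ _ → 1#) _) (+-cong (*-congˡ sum-1) (*-congˡ (≈-sym (ι-sum h)))))
               (-‿cong (≈-trans (·-linear H (ι 2ℚ * θ) (ι -1ℚ) (λ _ → 1#) _ i) (+-cong (*-congˡ (H·1 i)) (*-congˡ (H·h i)))))) ⟩
        ι ½ * (ι 2ℚ * θ * ι N + ι -1ℚ * ι e + - (ι 2ℚ * θ * ι (h i) + ι -1ℚ * ι N))
          ≈⟨ solve 4 (λ θ N e h →
                 con ½ :* (con 2ℚ :* θ :* N :+ con -1ℚ :* e :- (con 2ℚ :* θ :* h :+ con -1ℚ :* N))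
              := θ :* (con 2ℚ :* θ :+ con -1ℚ :* h) :- con ½ :* quadratic θ N e) ≈-refl θ (ι N) (ι e) (ι (h i)) ⟩
        θ * (ι 2ℚ * θ + ι -1ℚ * ι (h i)) + - (ι ½ * q θ)
          ≈⟨ +-cong (*-congˡ (+-congʳ (≈-sym (*-identityʳ _)))) (-‿cong (*-congˡ (≈-trans qθ≈0 (≈-sym 0-homo)))) ⟩
        θ * mainVector θ i + - (ι ½ * ι 0ℚ)
          ≈⟨ solve 1 (λ x → x :- con ½ :* con 0ℚ := x) ≈-refl (θ * mainVector θ i) ⟩
        θ * mainVector θ i ∎
        where open Solver

      -- On vectors of sum zero J vanishes and `A` acts as -½ `H`, which explains the sign of `c`
      -- and the factor ½.
      rational-eigen : ∀ c (y : Vector ℚ n) → ℚSum.sum y ≡ 0ℚ →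
                       (∀ i → ℚSum.sum (λ j → H i j ℚ.* y j) ≡ (ℚ.- c) ℚ.* y i) →
                       ∀ i → (A· λ j → ι (y j)) i ≈ ι (½ ℚ.* c) * ι (y i)
      rational-eigen c y Σy≡0 Hy≡-cy i = begin
        (A· λ j → ι (y j)) i
          ≈⟨ A·≈ (λ j → ι (y j)) i ⟩
        ι ½ * (sum (λ j → ι (y j)) + - (H · λ j → ι (y j)) i)
          ≈⟨ *-congˡ (+-cong (≈-trans (≈-sym (ι-sum y)) (ι-cong Σy≡0))
               (-‿cong (≈-trans (sum-cong {n} (λ j → ≈-sym (*-homo (H i j) (y j))))
                 (≈-trans (≈-sym (ι-sum (λ j → H i j ℚ.* y j))) (≈-trans (ι-cong (Hy≡-cy i)) (≈-trans (*-homo _ _) (*-congʳ (-‿homo c)))))))) ⟩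
        ι ½ * (ι 0ℚ + - ((- ι c) * ι (y i)))
          ≈⟨ solve 2 (λ c y → con ½ :* (con 0ℚ :- ((:- c) :* y)) := con ½ :* c :* y) ≈-refl (ι c) (ι (y i)) ⟩
        ι ½ * ι c * ι (y i)
          ≈⟨ *-congʳ (*-homo ½ c) ⟨
        ι (½ ℚ.* c) * ι (y i) ∎
        where open Solver

-- Irregularity over the rationals: the variance of h and eigenvectors of sum zero.

module ℚΣ = RationalAlgebra ℚ.+-*-commutativeRing
  (-raw-almostCommutative⟶ (fromCommutativeRing ℚ.+-*-commutativeRing))

δ-diag : ∀ {n} (i : Fin n) → δ i i ≡ 1ℚ
δ-diag zero    = refl
δ-diag (suc i) = δ-diag i

δ-off : ∀ {n} {i j : Fin n} → i ≢ j → δ i j ≡ 0ℚ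
δ-off {i = zero}  {zero}  i≢j = contradiction refl i≢j
δ-off {i = zero}  {suc j} i≢j = refl
δ-off {i = suc i} {zero}  i≢j = refl
δ-off {i = suc i} {suc j} i≢j = δ-off (i≢j ∘ cong suc)

cancel-≢0 : ∀ p {q} → p ≢ 0ℚ → p ℚ.* q ≡ 0ℚ → q ≡ 0ℚ
cancel-≢0 p {q} p≢0 pq≡0 = begin
  q                        ≡⟨ ℚ.*-identityˡ q ⟨
  1ℚ ℚ.* q                 ≡⟨ cong (ℚ._* q) (ℚ.*-inverseˡ p) ⟨
  ℚ.1/ p ℚ.* p ℚ.* q       ≡⟨ ℚ.*-assoc (ℚ.1/ p) p q ⟩
  ℚ.1/ p ℚ.* (p ℚ.* q)     ≡⟨ cong (ℚ.1/ p ℚ.*_) pq≡0 ⟩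
  ℚ.1/ p ℚ.* 0ℚ            ≡⟨ ℚ.*-zeroʳ (ℚ.1/ p) ⟩
  0ℚ                       ∎
  where
  open ≡-Reasoning
  instance
    p-nonZero : ℚ.NonZero p
    p-nonZero = ℚ.≢-nonZero p≢0

0≤p*p : ∀ p → 0ℚ ℚ.≤ p ℚ.* p
0≤p*p p with ℚ.≤-total 0ℚ p
... | inj₁ 0≤p = ℚ.nonNegative⁻¹ (p ℚ.* p) {{ℚ.nonNeg*nonNeg⇒nonNeg p {{ℚ.nonNegative 0≤p}} p {{ℚ.nonNegative 0≤p}}}}
... | inj₂ p≤0 = ℚ.nonNegative⁻¹ (p ℚ.* p) {{ℚ.nonPos*nonPos⇒nonPos p {{ℚ.nonPositive p≤0}} p {{ℚ.nonPositive p≤0}}}}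

0<p*p : ∀ p → p ≢ 0ℚ → 0ℚ ℚ.< p ℚ.* p
0<p*p p p≢0 = ℚ.≰⇒> λ p*p≤0 → p≢0 (cancel-≢0 p p≢0 (ℚ.≤-antisym p*p≤0 (0≤p*p p)))

p-q≡0⇒p≡q : ∀ p q → p ℚ.- q ≡ 0ℚ → p ≡ q
p-q≡0⇒p≡q p q p-q≡0 = begin
  p                ≡⟨ solve 2 (λ p q → p := (p :- q) :+ q) refl p q ⟩
  p ℚ.- q ℚ.+ q    ≡⟨ cong (ℚ._+ q) p-q≡0 ⟩
  0ℚ ℚ.+ q         ≡⟨ ℚ.+-identityˡ q ⟩
  q                ∎
  where
  open +-*-Solver
  open ≡-Reasoning

sum-nonneg : ∀ {n} {u : Vector ℚ n} → (∀ i → 0ℚ ℚ.≤ u i) → 0ℚ ℚ.≤ ℚΣ.sum u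
sum-nonneg {zero}  0≤u = ℚ.≤-refl
sum-nonneg {suc n} 0≤u = ℚ.+-mono-≤ (0≤u zero) (sum-nonneg (λ i → 0≤u (suc i)))

sum-pos : ∀ {n} {u : Vector ℚ n} → (∀ i → 0ℚ ℚ.≤ u i) → ∀ i → 0ℚ ℚ.< u i → 0ℚ ℚ.< ℚΣ.sum u
sum-pos 0≤u zero    0<ui = ℚ.+-mono-<-≤ 0<ui (sum-nonneg (λ i → 0≤u (suc i)))
sum-pos 0≤u (suc i) 0<ui = ℚ.+-mono-≤-< (0≤u zero) (sum-pos (λ i → 0≤u (suc i)) i 0<ui)

module RationalHadamard {n} (H : Fin n → Fin n → ℚ) (N : ℚ)
  (n≡N : ℚΣ.sum {n} (λ _ → 1ℚ) ≡ N)
  (H-sym : ∀ i j → H i j ≡ H j i)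
  (H-orth : ∀ i j → ℚΣ.sum (λ k → H i k ℚ.* H k j) ≡ N ℚ.* δ i j)
  (H-unit : ∀ i j → H i j ℚ.* H i j ≡ 1ℚ)
  (H-diag : ∀ i → H i i ≡ 1ℚ)
  where

  open ℚΣ.Hadamard H N n≡N H-sym H-orth public

  module _ (i₀ j₀ : Fin n) (irregular : h i₀ ≢ h j₀) (c : ℚ) (c²≡N : c ℚ.* c ≡ N) where

    -- Σ h² = 1ᵀ H² 1 = N², so expanding the square leaves 2N² - 2ce, and N² = c (N c) because c² =
    -- N. The lemma serves both signs of the root `c`.
    variance : ℚΣ.sum (λ i → (h i ℚ.- c) ℚ.* (h i ℚ.- c)) ≡ (c ℚ.+ c) ℚ.* (N ℚ.* c ℚ.- e)
    variance = begin
      ℚΣ.sum (λ i → (h i ℚ.- c) ℚ.* (h i ℚ.- c))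
        ≡⟨ ℚΣ.sum-cong {n} (λ i → solve 2 (λ h c → (h :- c) :* (h :- c) := con 1ℚ :* (con 1ℚ :* (h :* h) :+ (:- (c :+ c)) :* h) :+ (c :* c) :* con 1ℚ) refl (h i) c) ⟩
      ℚΣ.sum (λ i → 1ℚ ℚ.* (1ℚ ℚ.* (h i ℚ.* h i) ℚ.+ (ℚ.- (c ℚ.+ c)) ℚ.* h i) ℚ.+ c ℚ.* c ℚ.* 1ℚ)
        ≡⟨ ℚΣ.sum-linear {n} 1ℚ (c ℚ.* c) _ (λ _ → 1ℚ) ⟩
      1ℚ ℚ.* ℚΣ.sum (λ i → 1ℚ ℚ.* (h i ℚ.* h i) ℚ.+ (ℚ.- (c ℚ.+ c)) ℚ.* h i) ℚ.+ c ℚ.* c ℚ.* ℚΣ.sum {n} (λ _ → 1ℚ)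
        ≡⟨ cong₂ (λ x y → 1ℚ ℚ.* x ℚ.+ c ℚ.* c ℚ.* y) (ℚΣ.sum-linear {n} 1ℚ (ℚ.- (c ℚ.+ c)) (λ i → h i ℚ.* h i) h) n≡N ⟩
      1ℚ ℚ.* (1ℚ ℚ.* ℚΣ.sum (λ i → h i ℚ.* h i) ℚ.+ (ℚ.- (c ℚ.+ c)) ℚ.* e) ℚ.+ c ℚ.* c ℚ.* N
        ≡⟨ cong (λ x → 1ℚ ℚ.* (1ℚ ℚ.* x ℚ.+ (ℚ.- (c ℚ.+ c)) ℚ.* e) ℚ.+ c ℚ.* c ℚ.* N) Σh² ⟩
      1ℚ ℚ.* (1ℚ ℚ.* (N ℚ.* N) ℚ.+ (ℚ.- (c ℚ.+ c)) ℚ.* e) ℚ.+ c ℚ.* c ℚ.* N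
        -- Writing c² for `N` turns the claim into a polynomial identity in `c` and `e` alone; `N`
        -- is restored at the end.
        ≡⟨ cong (λ N → 1ℚ ℚ.* (1ℚ ℚ.* (N ℚ.* N) ℚ.+ (ℚ.- (c ℚ.+ c)) ℚ.* e) ℚ.+ c ℚ.* c ℚ.* N) c²≡N ⟨
      1ℚ ℚ.* (1ℚ ℚ.* (c ℚ.* c ℚ.* (c ℚ.* c)) ℚ.+ (ℚ.- (c ℚ.+ c)) ℚ.* e) ℚ.+ c ℚ.* c ℚ.* (c ℚ.* c)
        ≡⟨ solve 2 (λ c e → con 1ℚ :* (con 1ℚ :* (c :* c :* (c :* c)) :+ (:- (c :+ c)) :* e) :+ c :* c :* (c :* c)
                          := (c :+ c) :* (c :* c :* c :- e)) refl c e ⟩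
      (c ℚ.+ c) ℚ.* (c ℚ.* c ℚ.* c ℚ.- e)
        ≡⟨ cong (λ N → (c ℚ.+ c) ℚ.* (N ℚ.* c ℚ.- e)) c²≡N ⟩
      (c ℚ.+ c) ℚ.* (N ℚ.* c ℚ.- e) ∎
      where
      open +-*-Solver
      open ≡-Reasoning
      Σh² : ℚΣ.sum (λ i → h i ℚ.* h i) ≡ N ℚ.* N
      Σh² = begin
        ℚΣ.sum (λ i → h i ℚ.* h i)    ≡⟨ sum-H· h ⟨
        ℚΣ.sum (H ℚΣ.· h)             ≡⟨ ℚΣ.sum-cong {n} (λ i → trans (H·h i) (sym (ℚ.*-identityʳ N))) ⟩
        ℚΣ.sum {n} (λ _ → N ℚ.* 1ℚ)   ≡⟨ ℚΣ.*-distribˡ-sum {n} N (λ _ → 1ℚ) ⟨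
        N ℚ.* ℚΣ.sum {n} (λ _ → 1ℚ)   ≡⟨ cong (N ℚ.*_) n≡N ⟩
        N ℚ.* N                       ∎

    off-average : ∃[ i ] h i ≢ c
    off-average with h i₀ ℚ.≟ c
    ... | no  hi≢c = i₀ , hi≢c
    ... | yes hi≡c = j₀ , λ hj≡c → irregular (trans hi≡c (sym hj≡c))

    0<variance : 0ℚ ℚ.< (c ℚ.+ c) ℚ.* (N ℚ.* c ℚ.- e)
    0<variance = let i , hi≢c = off-average in
      subst (0ℚ ℚ.<_) variance (sum-pos (λ i → 0≤p*p (h i ℚ.- c)) i
        (0<p*p (h i ℚ.- c) (λ hi-c≡0 → hi≢c (p-q≡0⇒p≡q (h i) c hi-c≡0))))

    -- This number is q(c/2), so ±√N / 2 are not roots of q.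
    e≢Nc : e ℚ.- N ℚ.* c ≢ 0ℚ
    e≢Nc e-Nc≡0 = ℚ.<⇒≢ 0<variance (sym (begin
      (c ℚ.+ c) ℚ.* (N ℚ.* c ℚ.- e)        ≡⟨ solve 3 (λ N c e → (c :+ c) :* (N :* c :- e) := (:- (c :+ c)) :* (e :- N :* c)) refl N c e ⟩
      (ℚ.- (c ℚ.+ c)) ℚ.* (e ℚ.- N ℚ.* c)  ≡⟨ cong ((ℚ.- (c ℚ.+ c)) ℚ.*_) e-Nc≡0 ⟩
      (ℚ.- (c ℚ.+ c)) ℚ.* 0ℚ               ≡⟨ ℚ.*-zeroʳ (ℚ.- (c ℚ.+ c)) ⟩
      0ℚ                                   ∎))
      where
      open +-*-Solver
      open ≡-Reasoning

    -- y = (H - c) x satisfies H y = -c y because H² = c²; the weights α, β of x make Σ y = 0.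
    α β : ℚ
    α = h j₀ ℚ.- c
    β = ℚ.- (h i₀ ℚ.- c)

    x y : Vector ℚ n
    x k = α ℚ.* δ i₀ k ℚ.+ β ℚ.* δ j₀ k
    y k = 1ℚ ℚ.* (H ℚΣ.· x) k ℚ.+ (ℚ.- c) ℚ.* x k

    H·δ : ∀ i k → (H ℚΣ.· δ i) k ≡ H k i
    H·δ i k = trans (ℚΣ.sum-cong {n} (λ j → ℚ.*-comm (H k j) (δ i j))) (ℚΣ.sum-δ i (H k))

    H·x : ∀ k → (H ℚΣ.· x) k ≡ α ℚ.* H k i₀ ℚ.+ β ℚ.* H k j₀
    H·x k = trans (ℚΣ.·-linear H α β (δ i₀) (δ j₀) k) (cong₂ (λ a b → α ℚ.* a ℚ.+ β ℚ.* b) (H·δ i₀ k) (H·δ j₀ k))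

    H·y : ∀ k → (H ℚΣ.· y) k ≡ (ℚ.- c) ℚ.* y k
    H·y k = begin
      (H ℚΣ.· y) k                                              ≡⟨ ℚΣ.·-linear H 1ℚ (ℚ.- c) (H ℚΣ.· x) x k ⟩
      1ℚ ℚ.* (H ℚΣ.· H ℚΣ.· x) k ℚ.+ (ℚ.- c) ℚ.* (H ℚΣ.· x) k   ≡⟨ cong (λ t → 1ℚ ℚ.* t ℚ.+ (ℚ.- c) ℚ.* (H ℚΣ.· x) k) (trans (H·H· x k) (cong (ℚ._* x k) (sym c²≡N))) ⟩
      1ℚ ℚ.* (c ℚ.* c ℚ.* x k) ℚ.+ (ℚ.- c) ℚ.* (H ℚΣ.· x) k     ≡⟨ solve 3 (λ c x Hx → con 1ℚ :* (c :* c :* x) :+ (:- c) :* Hx := (:- c) :* (con 1ℚ :* Hx :+ (:- c) :* x)) refl c (x k) ((H ℚΣ.· x) k) ⟩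
      (ℚ.- c) ℚ.* y k                                           ∎
      where
      open +-*-Solver
      open ≡-Reasoning

    Σx : ∀ (u : Vector ℚ n) → ℚΣ.sum (λ k → u k ℚ.* x k) ≡ α ℚ.* u i₀ ℚ.+ β ℚ.* u j₀
    Σx u = begin
      ℚΣ.sum (λ k → u k ℚ.* x k)
        ≡⟨ ℚΣ.sum-cong {n} (λ k → solve 5 (λ u a b d e → u :* (a :* d :+ b :* e) := a :* (d :* u) :+ b :* (e :* u)) refl (u k) α β (δ i₀ k) (δ j₀ k)) ⟩
      ℚΣ.sum (λ k → α ℚ.* (δ i₀ k ℚ.* u k) ℚ.+ β ℚ.* (δ j₀ k ℚ.* u k))
        ≡⟨ ℚΣ.sum-linear {n} α β _ _ ⟩
      α ℚ.* ℚΣ.sum (λ k → δ i₀ k ℚ.* u k) ℚ.+ β ℚ.* ℚΣ.sum (λ k → δ j₀ k ℚ.* u k)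
        ≡⟨ cong₂ (λ a b → α ℚ.* a ℚ.+ β ℚ.* b) (ℚΣ.sum-δ i₀ u) (ℚΣ.sum-δ j₀ u) ⟩
      α ℚ.* u i₀ ℚ.+ β ℚ.* u j₀ ∎
      where
      open +-*-Solver
      open ≡-Reasoning

    sum-y : ℚΣ.sum y ≡ 0ℚ
    sum-y = begin
      ℚΣ.sum y
        ≡⟨ ℚΣ.sum-linear {n} 1ℚ (ℚ.- c) (H ℚΣ.· x) x ⟩
      1ℚ ℚ.* ℚΣ.sum (H ℚΣ.· x) ℚ.+ (ℚ.- c) ℚ.* ℚΣ.sum x
        ≡⟨ cong₂ (λ a b → 1ℚ ℚ.* a ℚ.+ (ℚ.- c) ℚ.* b) (trans (sum-H· x) (Σx h))
             (trans (ℚΣ.sum-cong {n} (λ k → sym (ℚ.*-identityˡ (x k)))) (Σx (λ _ → 1ℚ))) ⟩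
      1ℚ ℚ.* (α ℚ.* h i₀ ℚ.+ β ℚ.* h j₀) ℚ.+ (ℚ.- c) ℚ.* (α ℚ.* 1ℚ ℚ.+ β ℚ.* 1ℚ)
        ≡⟨ solve 3 (λ c a b → con 1ℚ :* ((b :- c) :* a :+ (:- (a :- c)) :* b) :+ (:- c) :* ((b :- c) :* con 1ℚ :+ (:- (a :- c)) :* con 1ℚ) := con 0ℚ)
             refl c (h i₀) (h j₀) ⟩
      0ℚ ∎
      where
      open +-*-Solver
      open ≡-Reasoning

    -- If `y` vanishes at `i₀` and at `j₀`, then with η = ±1 the pair (α, βη) is in the kernel of
    -- the 2 by 2 matrix with diagonal 1 - c and off-diagonal 1. Its eigenvalues are 2 - c, on sums,
    -- and -c, on differences, so α = β = 0; then both row sums equal `c`, against irregularity.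
    -- This is where N = 4 is excluded.
    y-nonzero : c ≢ 0ℚ → c ℚ.- (1ℚ ℚ.+ 1ℚ) ≢ 0ℚ → ∃[ k ] y k ≢ 0ℚ
    y-nonzero c≢0 c≢2 with y i₀ ℚ.≟ 0ℚ | y j₀ ℚ.≟ 0ℚ
    ... | no yi≢0 | _       = i₀ , yi≢0
    ... | yes _   | no yj≢0 = j₀ , yj≢0
    ... | yes yi≡0 | yes yj≡0 = contradiction hi≡hj irregular
      where
      open +-*-Solver
      open ≡-Reasoning
      η : ℚ
      η = H i₀ j₀
      i≢j : i₀ ≢ j₀
      i≢j refl = irregular refl
      yi : α ℚ.* (1ℚ ℚ.- c) ℚ.+ β ℚ.* η ≡ 0ℚ
      yi = begin
        α ℚ.* (1ℚ ℚ.- c) ℚ.+ β ℚ.* η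
          ≡⟨ solve 4 (λ a b c e → a :* (con 1ℚ :- c) :+ b :* e := con 1ℚ :* (a :* con 1ℚ :+ b :* e) :+ (:- c) :* (a :* con 1ℚ :+ b :* con 0ℚ)) refl α β c η ⟩
        1ℚ ℚ.* (α ℚ.* 1ℚ ℚ.+ β ℚ.* η) ℚ.+ (ℚ.- c) ℚ.* (α ℚ.* 1ℚ ℚ.+ β ℚ.* 0ℚ)
          ≡⟨ cong₂ (λ s t → 1ℚ ℚ.* s ℚ.+ (ℚ.- c) ℚ.* t)
               (trans (H·x i₀) (cong (λ s → α ℚ.* s ℚ.+ β ℚ.* η) (H-diag i₀)))
               (cong₂ (λ s t → α ℚ.* s ℚ.+ β ℚ.* t) (δ-diag i₀) (δ-off (i≢j ∘ sym))) ⟨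
        y i₀ ≡⟨ yi≡0 ⟩
        0ℚ ∎
      yj : α ℚ.* η ℚ.+ β ℚ.* (1ℚ ℚ.- c) ≡ 0ℚ
      yj = begin
        α ℚ.* η ℚ.+ β ℚ.* (1ℚ ℚ.- c)
          ≡⟨ solve 4 (λ a b c e → a :* e :+ b :* (con 1ℚ :- c) := con 1ℚ :* (a :* e :+ b :* con 1ℚ) :+ (:- c) :* (a :* con 0ℚ :+ b :* con 1ℚ)) refl α β c η ⟩
        1ℚ ℚ.* (α ℚ.* η ℚ.+ β ℚ.* 1ℚ) ℚ.+ (ℚ.- c) ℚ.* (α ℚ.* 0ℚ ℚ.+ β ℚ.* 1ℚ)
          ≡⟨ cong₂ (λ s t → 1ℚ ℚ.* s ℚ.+ (ℚ.- c) ℚ.* t)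
               (trans (H·x j₀) (cong₂ (λ s t → α ℚ.* s ℚ.+ β ℚ.* t) (H-sym j₀ i₀) (H-diag j₀)))
               (cong₂ (λ s t → α ℚ.* s ℚ.+ β ℚ.* t) (δ-off i≢j) (δ-diag j₀)) ⟨
        y j₀ ≡⟨ yj≡0 ⟩
        0ℚ ∎
      η-yj : α ℚ.+ β ℚ.* η ℚ.* (1ℚ ℚ.- c) ≡ 0ℚ
      η-yj = begin
        α ℚ.+ β ℚ.* η ℚ.* (1ℚ ℚ.- c)
          ≡⟨ cong (ℚ._+ β ℚ.* η ℚ.* (1ℚ ℚ.- c)) (trans (cong (α ℚ.*_) (H-unit i₀ j₀)) (ℚ.*-identityʳ α)) ⟨
        α ℚ.* (η ℚ.* η) ℚ.+ β ℚ.* η ℚ.* (1ℚ ℚ.- c)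
          ≡⟨ solve 4 (λ a b c e → a :* (e :* e) :+ b :* e :* (con 1ℚ :- c) := e :* (a :* e :+ b :* (con 1ℚ :- c))) refl α β c η ⟩
        η ℚ.* (α ℚ.* η ℚ.+ β ℚ.* (1ℚ ℚ.- c))
          ≡⟨ cong (η ℚ.*_) yj ⟩
        η ℚ.* 0ℚ
          ≡⟨ ℚ.*-zeroʳ η ⟩
        0ℚ ∎
      α+βη≡0 : α ℚ.+ β ℚ.* η ≡ 0ℚ
      α+βη≡0 = cancel-≢0 (c ℚ.- (1ℚ ℚ.+ 1ℚ)) c≢2 (begin
        (c ℚ.- (1ℚ ℚ.+ 1ℚ)) ℚ.* (α ℚ.+ β ℚ.* η)
          ≡⟨ solve 4 (λ a b c e → (c :- (con 1ℚ :+ con 1ℚ)) :* (a :+ b :* e)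
                := :- ((a :* (con 1ℚ :- c) :+ b :* e) :+ (a :+ b :* e :* (con 1ℚ :- c)))) refl α β c η ⟩
        ℚ.- ((α ℚ.* (1ℚ ℚ.- c) ℚ.+ β ℚ.* η) ℚ.+ (α ℚ.+ β ℚ.* η ℚ.* (1ℚ ℚ.- c)))
          ≡⟨ cong₂ (λ s t → ℚ.- (s ℚ.+ t)) yi η-yj ⟩
        0ℚ ∎)
      α-βη≡0 : α ℚ.- β ℚ.* η ≡ 0ℚ
      α-βη≡0 = cancel-≢0 c c≢0 (begin
        c ℚ.* (α ℚ.- β ℚ.* η)
          ≡⟨ solve 4 (λ a b c e → c :* (a :- b :* e)
                := (a :+ b :* e :* (con 1ℚ :- c)) :- (a :* (con 1ℚ :- c) :+ b :* e)) refl α β c η ⟩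
        (α ℚ.+ β ℚ.* η ℚ.* (1ℚ ℚ.- c)) ℚ.- (α ℚ.* (1ℚ ℚ.- c) ℚ.+ β ℚ.* η)
          ≡⟨ cong₂ (λ s t → s ℚ.- t) η-yj yi ⟩
        0ℚ ∎)
      hj≡c : α ≡ 0ℚ
      hj≡c = begin
        α
          ≡⟨ solve 2 (λ a b → a := con ½ :* ((a :+ b) :+ (a :- b))) refl α (β ℚ.* η) ⟩
        ½ ℚ.* ((α ℚ.+ β ℚ.* η) ℚ.+ (α ℚ.- β ℚ.* η))
          ≡⟨ cong₂ (λ s t → ½ ℚ.* (s ℚ.+ t)) α+βη≡0 α-βη≡0 ⟩
        0ℚ ∎
      hi≡c : β ≡ 0ℚ
      hi≡c = begin
        β
          ≡⟨ trans (cong (β ℚ.*_) (H-unit i₀ j₀)) (ℚ.*-identityʳ β) ⟨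
        β ℚ.* (η ℚ.* η)
          ≡⟨ solve 3 (λ a b e → b :* (e :* e) := e :* ((a :+ b :* e) :- a)) refl α β η ⟩
        η ℚ.* ((α ℚ.+ β ℚ.* η) ℚ.- α)
          ≡⟨ cong₂ (λ s t → η ℚ.* (s ℚ.- t)) α+βη≡0 hj≡c ⟩
        η ℚ.* (0ℚ ℚ.- 0ℚ)
          ≡⟨ ℚ.*-zeroʳ η ⟩
        0ℚ ∎
      hi≡hj : h i₀ ≡ h j₀
      hi≡hj = begin
        h i₀
          ≡⟨ solve 3 (λ a b c → a := b :- ((b :- c) :+ (:- (a :- c)))) refl (h i₀) (h j₀) c ⟩
        h j₀ ℚ.- (α ℚ.+ β)
          ≡⟨ cong₂ (λ s t → h j₀ ℚ.- (s ℚ.+ t)) hj≡c hi≡c ⟩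
        h j₀ ℚ.- 0ℚ
          ≡⟨ ℚ.+-identityʳ (h j₀) ⟩
        h j₀ ∎

-- The spectrum over a commutative ring with apartness.

module ApartAlgebra (R : CommutativeRing 0ℓ 0ℓ)
  (morphism : CommutativeRing.rawRing ℚ.+-*-commutativeRing -Raw-AlmostCommutative⟶ fromCommutativeRing R)
  where

  open CommutativeRing R hiding (zero) renaming (refl to ≈-refl; sym to ≈-sym; trans to ≈-trans)
  open RationalAlgebra R morphism
  open import Relation.Binary.Reasoning.Setoid setoid
  open Solver

  module Apartness
    (Apart0 : Carrier → Set)
    (resp   : ∀ x y → x ≈ y → Apart0 x → Apart0 y)
    (split  : ∀ x y → Apart0 (x + y) → Apart0 x ⊎ Apart0 y)
    (factor : ∀ x y → Apart0 (x * y) → Apart0 x)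
    (cancel : ∀ x y → Apart0 x → x * y ≈ 0# → y ≈ 0#)
    (const  : ∀ q → q ≢ 0ℚ → Apart0 (ι q))
    where

    infix 4 _⋕_
    _⋕_ : Carrier → Carrier → Set
    x ⋕ y = Apart0 (x - y)

    ⋕-sym : ∀ x y → x ⋕ y → y ⋕ x
    ⋕-sym x y x⋕y = factor (y - x) (ι (ℚ.- 1ℚ)) (resp (x - y) ((y - x) * ι (ℚ.- 1ℚ))
      (solve 2 (λ x y → x :- y := (y :- x) :* con (ℚ.- 1ℚ)) ≈-refl x y) x⋕y)

    rootProduct : Carrier → List Carrier → Carrier
    rootProduct μ = foldr (λ x p → (μ - x) * p) (ι 1ℚ)

    -- Of two roots that are apart, μ is apart from at least one, whose factor can be cancelled.
    locate : ∀ μ x xs → AllPairs _⋕_ (x ∷ xs) → rootProduct μ (x ∷ xs) ≈ 0# → Any (μ ≈_) (x ∷ xs)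
    locate μ x [] _ p≈0 = here (begin
      μ                        ≈⟨ solve 2 (λ μ x → μ := (μ :- x) :* con 1ℚ :+ x) ≈-refl μ x ⟩
      (μ - x) * ι 1ℚ + x       ≈⟨ +-congʳ p≈0 ⟩
      0# + x                   ≈⟨ +-identityˡ x ⟩
      x                        ∎)
    locate μ x (y ∷ zs) ((x⋕y ∷ x⋕zs) ∷ y⋕zs ∷ zs⋕) p≈0 =
      [ (λ μ⋕y → skip (locate μ x zs (x⋕zs ∷ zs⋕) (cancel (μ - y) ((μ - x) * rootProduct μ zs) μ⋕y
            (≈-trans (solve 3 (λ a b p → b :* (a :* p) := a :* (b :* p)) ≈-refl (μ - x) (μ - y) (rootProduct μ zs)) p≈0))))
      , (λ x⋕μ → there (locate μ y zs (y⋕zs ∷ zs⋕)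
            (cancel (μ - x) ((μ - y) * rootProduct μ zs) (⋕-sym x μ x⋕μ) p≈0)))
      ]′ (split (μ - y) (x - μ) (resp (x - y) ((μ - y) + (x - μ))
           (solve 3 (λ μ x y → x :- y := (μ :- y) :+ (x :- μ)) ≈-refl μ x y) x⋕y))
      where
      skip : Any (μ ≈_) (x ∷ zs) → Any (μ ≈_) (x ∷ y ∷ zs)
      skip (here μ≈x) = here μ≈x
      skip (there μ∈) = there (there μ∈)

    -- The source of every separation between the four eigenvalues: their differences are exhibited
    -- as factors of nonzero rationals.
    apart-by : ∀ x y z {r} → r ≢ 0ℚ → (x - y) * z ≈ ι r → x ⋕ y
    apart-by x y z {r} r≢0 eq = factor (x - y) z (resp (ι r) ((x - y) * z) (≈-sym eq) (const r r≢0))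

    module Spectrum {n} (H : Fin n → Fin n → ℚ) (N : ℚ)
      (n≡N : ℚΣ.sum {n} (λ _ → 1ℚ) ≡ N)
      (H-sym : ∀ i j → H i j ≡ H j i)
      (H-orth : ∀ i j → ℚΣ.sum (λ k → H i k ℚ.* H k j) ≡ N ℚ.* δ i j)
      (H-unit : ∀ i j → H i j ℚ.* H i j ≡ 1ℚ)
      (H-diag : ∀ i → H i i ≡ 1ℚ)
      {i₀ j₀ : Fin n} (irregular : ℚΣ.sum (H i₀) ≢ ℚΣ.sum (H j₀))
      (s : ℚ) (s²≡N : s ℚ.* s ≡ N) (0<s : 0ℚ ℚ.< s)
      (s≢2 : s ℚ.- (1ℚ ℚ.+ 1ℚ) ≢ 0ℚ)
      (A : Fin n → Fin n → Carrier)
      (A≈ : ∀ i j → A i j ≈ ι (½ ℚ.* (1ℚ ℚ.- H i j)))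
      where

      private module Q = RationalHadamard H N n≡N H-sym H-orth H-unit H-diag
      open Hadamard H N n≡N H-sym H-orth
      open Adjacency A A≈

      -- D is the discriminant of λ² - Nλ + (e - N); it is positive because it equals
      -- (s (s - 2))² + 4 (N s - e) and 2 s (N s - e) = Σ (h - s)².
      4ℚ D : ℚ
      4ℚ = 2ℚ ℚ.+ 2ℚ
      D = N ℚ.* N ℚ.+ 4ℚ ℚ.* (N ℚ.- e)

      0<D : 0ℚ ℚ.< D
      0<D = subst (0ℚ ℚ.<_) (sym D≡) (ℚ.+-mono-≤-< (0≤p*p (s ℚ.* (s ℚ.- 2ℚ))) 0<4X)
        where
        X : ℚ
        X = N ℚ.* s ℚ.- e
        0<X : 0ℚ ℚ.< X
        0<X = ℚ.*-cancelˡ-<-nonNeg (s ℚ.+ s) {{ℚ.nonNegative (ℚ.<⇒≤ (ℚ.+-mono-< 0<s 0<s))}}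
          (subst (ℚ._< (s ℚ.+ s) ℚ.* X) (sym (ℚ.*-zeroʳ (s ℚ.+ s))) (Q.0<variance i₀ j₀ irregular s s²≡N))
        0<4X : 0ℚ ℚ.< (X ℚ.+ X) ℚ.+ (X ℚ.+ X)
        0<4X = ℚ.+-mono-< (ℚ.+-mono-< 0<X 0<X) (ℚ.+-mono-< 0<X 0<X)
        D≡ : D ≡ s ℚ.* (s ℚ.- 2ℚ) ℚ.* (s ℚ.* (s ℚ.- 2ℚ)) ℚ.+ ((X ℚ.+ X) ℚ.+ (X ℚ.+ X))
        D≡ = subst (λ N → N ℚ.* N ℚ.+ 4ℚ ℚ.* (N ℚ.- e) ≡ s ℚ.* (s ℚ.- 2ℚ) ℚ.* (s ℚ.* (s ℚ.- 2ℚ)) ℚ.+ (((N ℚ.* s ℚ.- e) ℚ.+ (N ℚ.* s ℚ.- e)) ℚ.+ ((N ℚ.* s ℚ.- e) ℚ.+ (N ℚ.* s ℚ.- e))))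
          s²≡N (+-*-Solver.solve 2 (λ s e → (s ⊗ s) ⊗ (s ⊗ s) ⊕ c 4ℚ ⊗ (s ⊗ s ⊝ e)
              ≔ s ⊗ (s ⊝ c 2ℚ) ⊗ (s ⊗ (s ⊝ c 2ℚ)) ⊕ (((s ⊗ s ⊗ s ⊝ e) ⊕ (s ⊗ s ⊗ s ⊝ e)) ⊕ ((s ⊗ s ⊗ s ⊝ e) ⊕ (s ⊗ s ⊗ s ⊝ e)))) refl s e)
          where open +-*-Solver using () renaming (_:+_ to infixl 6 _⊕_; _:*_ to infixl 7 _⊗_; _:-_ to infixl 6 _⊝_; _:=_ to infix 4 _≔_; con to c)

      module _ (ρ : Carrier) (ρ²≈D : ρ * ρ ≈ ι D) where

        ¼ : ℚ
        ¼ = ½ ℚ.* ½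

        -- The discriminant `D` belongs to the quadratic in λ = 2θ, with roots (N ± ρ)/2; hence the
        -- quarter here.
        θ₊ θ₋ : Carrier
        θ₊ = ι ¼ * (ι N + ρ)
        θ₋ = ι ¼ * (ι N + - ρ)

        ρ² : ρ * ρ ≈ ι N * ι N + ι 4ℚ * (ι N + - ι e)
        ρ² = begin
          ρ * ρ                                  ≈⟨ ρ²≈D ⟩
          ι D                                    ≈⟨ +-homo _ _ ⟩
          ι (N ℚ.* N) + ι (4ℚ ℚ.* (N ℚ.- e))     ≈⟨ +-cong (*-homo N N) (≈-trans (*-homo 4ℚ _) (*-congˡ (≈-trans (+-homo N _) (+-congˡ (-‿homo e))))) ⟩
          ι N * ι N + ι 4ℚ * (ι N + - ι e)       ∎

        q-factor : ∀ θ → q θ ≈ ι 4ℚ * ((θ + - θ₊) * (θ + - θ₋))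
        q-factor θ = begin
          q θ
            -- Completing the square: e - N is rewritten as a quarter of N² - D, so that ρ² can
            -- replace D and the difference of squares factors.
            ≈⟨ solve 3 (λ t N e →
                 (con 2ℚ :* t) :* (con 2ℚ :* t) :- N :* (con 2ℚ :* t) :+ (e :- N)
                 := con 4ℚ :* (t :* t) :- con 2ℚ :* (N :* t) :+ con ¼ :* (N :* N :- (N :* N :+ con 4ℚ :* (N :- e)))) ≈-refl θ (ι N) (ι e) ⟩
          ι 4ℚ * (θ * θ) + - (ι 2ℚ * (ι N * θ)) + ι ¼ * (ι N * ι N + - (ι N * ι N + ι 4ℚ * (ι N + - ι e)))
            ≈⟨ +-congˡ (*-congˡ (+-congˡ (-‿cong ρ²))) ⟨
          ι 4ℚ * (θ * θ) + - (ι 2ℚ * (ι N * θ)) + ι ¼ * (ι N * ι N + - (ρ * ρ))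
            ≈⟨ solve 3 (λ t N r → con 4ℚ :* (t :* t) :- con 2ℚ :* (N :* t) :+ con ¼ :* (N :* N :- r :* r)
                 := con 4ℚ :* ((t :- con ¼ :* (N :+ r)) :* (t :- con ¼ :* (N :- r)))) ≈-refl θ (ι N) ρ ⟩
          ι 4ℚ * ((θ + - θ₊) * (θ + - θ₋)) ∎

        qθ₊≈0 : q θ₊ ≈ 0#
        qθ₊≈0 = begin
          q θ₊                                       ≈⟨ q-factor θ₊ ⟩
          ι 4ℚ * ((θ₊ + - θ₊) * (θ₊ + - θ₋))         ≈⟨ *-congˡ (≈-trans (*-congʳ (-‿inverseʳ θ₊)) (zeroˡ _)) ⟩
          ι 4ℚ * 0#                                  ≈⟨ zeroʳ _ ⟩
          0#                                         ∎

        qθ₋≈0 : q θ₋ ≈ 0#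
        qθ₋≈0 = begin
          q θ₋                                       ≈⟨ q-factor θ₋ ⟩
          ι 4ℚ * ((θ₋ + - θ₊) * (θ₋ + - θ₋))         ≈⟨ *-congˡ (≈-trans (*-congˡ (-‿inverseʳ θ₋)) (zeroʳ _)) ⟩
          ι 4ℚ * 0#                                  ≈⟨ zeroʳ _ ⟩
          0#                                         ∎

        -- The difference of the entries at `i₀` and `j₀` is the nonzero rational h j₀ - h i₀,
        -- whatever θ is, so one of the two entries is apart from 0.
        mainVector-apart : ∀ θ → ∃[ i ] Apart0 (mainVector θ i)
        mainVector-apart θ =
          [ (λ vi → i₀ , vi)
          , (λ vj → j₀ , factor (mainVector θ j₀) (ι -1ℚ)
              (resp (ι -1ℚ * mainVector θ j₀) (mainVector θ j₀ * ι -1ℚ) (*-comm (ι -1ℚ) (mainVector θ j₀)) vj))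
          ]′ (split (mainVector θ i₀) (ι -1ℚ * mainVector θ j₀)
              (resp (ι (h j₀ ℚ.- h i₀)) (mainVector θ i₀ + ι -1ℚ * mainVector θ j₀) difference
                (const (h j₀ ℚ.- h i₀) λ eq → irregular (sym (p-q≡0⇒p≡q (h j₀) (h i₀) eq)))))
          where
          difference : ι (h j₀ ℚ.- h i₀) ≈ mainVector θ i₀ + ι -1ℚ * mainVector θ j₀
          difference = begin
            ι (h j₀ ℚ.- h i₀)         ≈⟨ ≈-trans (+-homo (h j₀) (ℚ.- h i₀)) (+-congˡ (-‿homo (h i₀))) ⟩
            ι (h j₀) + - ι (h i₀)     ≈⟨ solve 3 (λ t a b → b :- a := (t :+ con -1ℚ :* a) :+ con -1ℚ :* (t :+ con -1ℚ :* b)) ≈-refl (ι 2ℚ * θ * 1#) (ι (h i₀)) (ι (h j₀)) ⟩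
            mainVector θ i₀ + ι -1ℚ * mainVector θ j₀ ∎

        module _ (c : ℚ) (c²≡N : c ℚ.* c ≡ N) (c≢0 : c ≢ 0ℚ) (c≢2 : c ℚ.- (1ℚ ℚ.+ 1ℚ) ≢ 0ℚ) where

          q-half : q (ι (½ ℚ.* c)) ≈ ι (e ℚ.- N ℚ.* c)
          q-half = begin
            q (ι (½ ℚ.* c))
              ≈⟨ +-congʳ (+-cong (*-cong 2½ 2½) (-‿cong (*-congˡ 2½))) ⟩
            ι c * ι c + - (ι N * ι c) + (ι e + - ι N)
              ≈⟨ +-congʳ (+-congʳ (≈-trans (≈-sym (*-homo c c)) (ι-cong c²≡N))) ⟩
            ι N + - (ι N * ι c) + (ι e + - ι N)
              ≈⟨ solve 3 (λ N c e → N :- N :* c :+ (e :- N) := e :- N :* c) ≈-refl (ι N) (ι c) (ι e) ⟩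
            ι e + - (ι N * ι c)
              ≈⟨ ≈-trans (+-homo _ _) (+-congˡ (≈-trans (-‿homo _) (-‿cong (*-homo N c)))) ⟨
            ι (e ℚ.- N ℚ.* c) ∎
            where
            2½ : ι 2ℚ * ι (½ ℚ.* c) ≈ ι c
            2½ = ≈-trans (*-congˡ (*-homo ½ c)) (solve 1 (λ c → con 2ℚ :* (con ½ :* c) := c) ≈-refl (ι c))

          -- c/2 - θ₊ is a factor of q(c/2) = e - Nc, a nonzero rational by the variance identity.
          half⋕θ₊ : ι (½ ℚ.* c) ⋕ θ₊
          half⋕θ₊ = apart-by (ι (½ ℚ.* c)) θ₊ (ι 4ℚ * (ι (½ ℚ.* c) - θ₋)) (Q.e≢Nc i₀ j₀ irregular c c²≡N)
            (≈-trans (solve 3 (λ a b f → a :* (f :* b) := f :* (a :* b)) ≈-refl (ι (½ ℚ.* c) - θ₊) (ι (½ ℚ.* c) - θ₋) (ι 4ℚ))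
              (≈-trans (≈-sym (q-factor (ι (½ ℚ.* c)))) q-half))

          half⋕θ₋ : ι (½ ℚ.* c) ⋕ θ₋
          half⋕θ₋ = apart-by (ι (½ ℚ.* c)) θ₋ (ι 4ℚ * (ι (½ ℚ.* c) - θ₊)) (Q.e≢Nc i₀ j₀ irregular c c²≡N)
            (≈-trans (solve 3 (λ a b f → b :* (f :* a) := f :* (a :* b)) ≈-refl (ι (½ ℚ.* c) - θ₊) (ι (½ ℚ.* c) - θ₋) (ι 4ℚ))
              (≈-trans (≈-sym (q-factor (ι (½ ℚ.* c)))) q-half))

          half-eigen : Σ[ v ∈ Vector Carrier n ] ((∃[ i ] Apart0 (v i)) × (∀ i → (A· v) i ≈ ι (½ ℚ.* c) * v i))
          half-eigen =
            let y = Q.y i₀ j₀ irregular c c²≡N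
                k , yk≢0 = Q.y-nonzero i₀ j₀ irregular c c²≡N c≢0 c≢2
            in (λ i → ι (y i)) , (k , const (y k) yk≢0)
               , rational-eigen c y (Q.sum-y i₀ j₀ irregular c c²≡N) (Q.H·y i₀ j₀ irregular c c²≡N)

        s≢0 : s ≢ 0ℚ
        s≢0 s≡0 = ℚ.<⇒≢ 0<s (sym s≡0)

        -s²≡N : (ℚ.- s) ℚ.* (ℚ.- s) ≡ N
        -s²≡N = trans (+-*-Solver.solve 1 (λ s → (⊝ s) ⊗ (⊝ s) ≔ s ⊗ s) refl s) s²≡N
          where open +-*-Solver using () renaming (_:*_ to infixl 7 _⊗_; :-_ to infix 8 ⊝_; _:=_ to infix 4 _≔_)

        -s<0 : ℚ.- s ℚ.< 0ℚ
        -s<0 = ℚ.neg-antimono-< 0<s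

        -s≢0 : ℚ.- s ≢ 0ℚ
        -s≢0 = ℚ.<⇒≢ -s<0

        -s≢2 : ℚ.- s ℚ.- (1ℚ ℚ.+ 1ℚ) ≢ 0ℚ
        -s≢2 = ℚ.<⇒≢ (ℚ.+-mono-< -s<0 (ℚ.negative⁻¹ (ℚ.- (1ℚ ℚ.+ 1ℚ))))

        θ : Vector Carrier 4
        θ 0F = ι (½ ℚ.* s)
        θ 1F = ι (½ ℚ.* (ℚ.- s))
        θ 2F = θ₊
        θ 3F = θ₋

        halves-apart : ι (½ ℚ.* s) ⋕ ι (½ ℚ.* (ℚ.- s))
        halves-apart = apart-by _ _ (ι 1ℚ) s≢0 (begin
          (ι (½ ℚ.* s) + - ι (½ ℚ.* (ℚ.- s))) * ι 1ℚ
            ≈⟨ *-congʳ (+-cong (*-homo ½ s) (-‿cong (≈-trans (*-homo ½ (ℚ.- s)) (*-congˡ (-‿homo s))))) ⟩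
          (ι ½ * ι s + - (ι ½ * - ι s)) * ι 1ℚ
            ≈⟨ solve 1 (λ s → (con ½ :* s :- con ½ :* (:- s)) :* con 1ℚ := s) ≈-refl (ι s) ⟩
          ι s ∎)

        θ±-apart : θ₊ ⋕ θ₋
        θ±-apart = apart-by θ₊ θ₋ (ι 2ℚ * ρ) (λ D≡0 → ℚ.<⇒≢ 0<D (sym D≡0))
          (≈-trans (solve 2 (λ N r → (con ¼ :* (N :+ r) :- con ¼ :* (N :- r)) :* (con 2ℚ :* r) := r :* r) ≈-refl (ι N) ρ) ρ²≈D)

        θ-apart : ∀ i j → i ≢ j → θ i ⋕ θ j
        θ-apart 0F 0F i≢j = contradiction refl i≢j
        θ-apart 0F 1F _   = halves-apart
        θ-apart 0F 2F _   = half⋕θ₊ s s²≡N s≢0 s≢2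
        θ-apart 0F 3F _   = half⋕θ₋ s s²≡N s≢0 s≢2
        θ-apart 1F 0F _   = ⋕-sym _ _ halves-apart
        θ-apart 1F 1F i≢j = contradiction refl i≢j
        θ-apart 1F 2F _   = half⋕θ₊ (ℚ.- s) -s²≡N -s≢0 -s≢2
        θ-apart 1F 3F _   = half⋕θ₋ (ℚ.- s) -s²≡N -s≢0 -s≢2
        θ-apart 2F 0F _   = ⋕-sym _ _ (half⋕θ₊ s s²≡N s≢0 s≢2)
        θ-apart 2F 1F _   = ⋕-sym _ _ (half⋕θ₊ (ℚ.- s) -s²≡N -s≢0 -s≢2)
        θ-apart 2F 2F i≢j = contradiction refl i≢j
        θ-apart 2F 3F _   = θ±-apart
        θ-apart 3F 0F _   = ⋕-sym _ _ (half⋕θ₋ s s²≡N s≢0 s≢2)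
        θ-apart 3F 1F _   = ⋕-sym _ _ (half⋕θ₋ (ℚ.- s) -s²≡N -s≢0 -s≢2)
        θ-apart 3F 2F _   = ⋕-sym _ _ θ±-apart
        θ-apart 3F 3F i≢j = contradiction refl i≢j

        θ-eigen : ∀ i → Σ[ v ∈ Vector Carrier n ] ((∃[ k ] Apart0 (v k)) × (∀ k → (A· v) k ≈ θ i * v k))
        θ-eigen 0F = half-eigen s s²≡N s≢0 s≢2
        θ-eigen 1F = half-eigen (ℚ.- s) -s²≡N -s≢0 -s≢2
        θ-eigen 2F = mainVector θ₊ , mainVector-apart θ₊ , mainVector-eigen θ₊ qθ₊≈0
        θ-eigen 3F = mainVector θ₋ , mainVector-apart θ₋ , mainVector-eigen θ₋ qθ₋≈0

        -- Both q(μ) and 4μ² - N split into 4 times two root factors, so their product is 16 times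
        -- the product `p` of all four. It annihilates `v k`; cancelling `v k` and the two constants
        -- 4 leaves p ≈ 0, and the pairwise apartness of the roots finds the one equal to μ.
        θ-complete : ∀ μ v k → Apart0 (v k) → (∀ i → (A· v) i ≈ μ * v i) → ∃[ i ] μ ≈ θ i
        θ-complete μ v k vk#0 Av≈μv = Any.tabulate⁻ (locate μ (θ 0F) (List.tabulate (λ i → θ (suc i)))
          (AllPairs.tabulate⁺ {f = θ} (λ {i} {j} → θ-apart i j)) p≈0)
          where
          p : Carrier
          p = rootProduct μ (List.tabulate θ)
          vffp≈0 : v k * (ι 4ℚ * (ι 4ℚ * p)) ≈ 0#
          vffp≈0 = begin
            v k * (ι 4ℚ * (ι 4ℚ * p))
              ≈⟨ solve 6 (λ v f a b c d → v :* (f :* (f :* (a :* (b :* (c :* (d :* con 1ℚ)))))) := (f :* (c :* d)) :* (f :* (a :* b)) :* v)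
                   ≈-refl (v k) (ι 4ℚ) (μ - θ 0F) (μ - θ 1F) (μ - θ 2F) (μ - θ 3F) ⟩
            ι 4ℚ * ((μ - θ₊) * (μ - θ₋)) * (ι 4ℚ * ((μ - θ 0F) * (μ - θ 1F))) * v k
              ≈⟨ *-congʳ (*-cong (q-factor μ) s-factor) ⟨
            q μ * ((ι 2ℚ * μ) * (ι 2ℚ * μ) + - ι N) * v k
              ≈⟨ eigenvalue-annihilates μ v Av≈μv k ⟩
            0# ∎
            where
            s-factor : (ι 2ℚ * μ) * (ι 2ℚ * μ) + - ι N ≈ ι 4ℚ * ((μ - θ 0F) * (μ - θ 1F))
            s-factor = begin
              (ι 2ℚ * μ) * (ι 2ℚ * μ) + - ι N
                ≈⟨ +-congˡ (-‿cong (≈-trans (≈-sym (*-homo s s)) (ι-cong s²≡N))) ⟨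
              (ι 2ℚ * μ) * (ι 2ℚ * μ) + - (ι s * ι s)
                ≈⟨ solve 2 (λ m s → (con 2ℚ :* m) :* (con 2ℚ :* m) :- s :* s := con 4ℚ :* ((m :- con ½ :* s) :* (m :- con ½ :* (:- s)))) ≈-refl μ (ι s) ⟩
              ι 4ℚ * ((μ - ι ½ * ι s) * (μ - ι ½ * - ι s))
                ≈⟨ *-congˡ (*-cong (+-congˡ (-‿cong (*-homo ½ s))) (+-congˡ (-‿cong (≈-trans (*-homo ½ (ℚ.- s)) (*-congˡ (-‿homo s)))))) ⟨
              ι 4ℚ * ((μ - θ 0F) * (μ - θ 1F)) ∎
          p≈0 : p ≈ 0#
          p≈0 = cancel (ι 4ℚ) p (const 4ℚ λ ())
            (cancel (ι 4ℚ) (ι 4ℚ * p) (const 4ℚ λ ())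
              (cancel (v k) (ι 4ℚ * (ι 4ℚ * p)) vk#0 vffp≈0))

-- The four eigenvalues over the Cauchy reals.

fromℚ-morphism : CommutativeRing.rawRing ℚ.+-*-commutativeRing -Raw-AlmostCommutative⟶ fromCommutativeRing ℝ-commutativeRing
fromℚ-morphism = record
  { ⟦_⟧    = fromℚ
  ; +-homo = λ p q → pointwise (fromℚ (p ℚ.+ q)) (fromℚ p +ℝ fromℚ q) λ _ → refl
  ; *-homo = λ p q → pointwise (fromℚ (p ℚ.* q)) (fromℚ p *ℝ fromℚ q) λ _ → refl
  ; -‿homo = λ p → pointwise (fromℚ (ℚ.- p)) (-ℝ fromℚ p) λ _ → refl
  ; 0-homo = pointwise (fromℚ 0ℚ) 0ℝ λ _ → refl
  ; 1-homo = pointwise (fromℚ 1ℚ) 1ℝ λ _ → refl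
  }

module ℝApart = ApartAlgebra.Apartness ℝ-commutativeRing fromℚ-morphism
  (_# 0ℝ) #0-resp-≃ #0-split #0-*ˡ #0-cancel fromℚ-#0

module _ {n} (H : Fin n → Fin n → ℚ) (N : ℚ)
  (n≡N : ℚSum.sum {n} (λ _ → 1ℚ) ≡ N)
  (H-sym : ∀ i j → H i j ≡ H j i)
  (H-orth : ∀ i j → ℚSum.sum (λ k → H i k ℚ.* H k j) ≡ N ℚ.* δ i j)
  (H-unit : ∀ i j → H i j ℚ.* H i j ≡ 1ℚ)
  (H-diag : ∀ i → H i i ≡ 1ℚ)
  {i₀ j₀ : Fin n} (irregular : ℚSum.sum (H i₀) ≢ ℚSum.sum (H j₀))
  (s : ℚ) (s²≡N : s ℚ.* s ≡ N) (0<s : 0ℚ ℚ.< s)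
  (s≢2 : s ℚ.- (1ℚ ℚ.+ 1ℚ) ≢ 0ℚ)
  (A : Matrix n)
  (A≈ : ∀ i j → A i j ≃ fromℚ (½ ℚ.* (1ℚ ℚ.- H i j)))
  where

  private
    module Spec = ℝApart.Spectrum H N n≡N H-sym H-orth H-unit H-diag irregular s s²≡N 0<s s≢2 A A≈
    module Root = SquareRoot (ℚ.<⇒≤ Spec.0<D)

  four-eigenvalues : HasExactlyDistinctEigenvalues 4 A
  four-eigenvalues =
      θ
    , (λ i j i≢j → -#0⇒# (θ i) (θ j) (Spec.θ-apart Root.√ Root.√*√≃D i j i≢j))
    , Spec.θ-eigen Root.√ Root.√*√≃D
    , (λ μ (v , (k , vk#0) , Av≃μv) → Spec.θ-complete Root.√ Root.√*√≃D μ v k vk#0 Av≃μv)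
    where
    θ : Fin 4 → ℝ
    θ = Spec.θ Root.√ Root.√*√≃D

-- The symplectic form on F₂²ʳ.

fst snd : Fin 4 → Bool
fst 0F = false
fst 1F = true
fst 2F = false
fst 3F = true
snd 0F = false
snd 1F = false
snd 2F = true
snd 3F = true

pair : Bool → Bool → Fin 4
pair false false = 0F
pair true  false = 1F
pair false true  = 2F
pair true  true  = 3F

det : Fin 4 → Fin 4 → Bool
det u v = (fst u ∧ snd v) xor (snd u ∧ fst v)

det-pair : ∀ a b c d → det (pair a b) (pair c d) ≡ (a ∧ d) xor (b ∧ c)
det-pair a b c d = cong₂ _xor_ (cong₂ _∧_ (fst-pair a b) (snd-pair c d)) (cong₂ _∧_ (snd-pair a b) (fst-pair c d))
  where
  fst-pair : ∀ a b → fst (pair a b) ≡ a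
  fst-pair false false = refl
  fst-pair false true  = refl
  fst-pair true  false = refl
  fst-pair true  true  = refl
  snd-pair : ∀ a b → snd (pair a b) ≡ b
  snd-pair false false = refl
  snd-pair false true  = refl
  snd-pair true  false = refl
  snd-pair true  true  = refl

det-sym : ∀ u v → det u v ≡ det v u
det-sym u v = trans (Bool.xor-comm (fst u ∧ snd v) (snd u ∧ fst v))
  (cong₂ _xor_ (Bool.∧-comm (snd u) (fst v)) (Bool.∧-comm (fst u) (snd v)))

det-alternating : ∀ u → det u u ≡ false
det-alternating u = trans (cong (_xor (snd u ∧ fst u)) (Bool.∧-comm (fst u) (snd u))) (Bool.xor-same (snd u ∧ fst u))

-- A vector of F₂²ʳ is coded by a number below 4ʳ whose base-4 digits are its components in the r
-- hyperbolic planes. Vectors thus serve directly as vertices and as matrix indices.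
V : ℕ → Set
V r = Fin (4 ^ r)

head : ∀ r → V (suc r) → Fin 4
head r x = proj₁ (remQuot (4 ^ r) x)

tail : ∀ r → V (suc r) → V r
tail r x = proj₂ (remQuot {4} (4 ^ r) x)

form : ∀ r → V r → V r → Bool
form zero    _ _ = false
form (suc r) x y = det (head r x) (head r y) xor form r (tail r x) (tail r y)

form-combine : ∀ r u x v y → form (suc r) (combine u x) (combine v y) ≡ det u v xor form r x y
form-combine r u x v y = cong₂ (λ a b → det (proj₁ a) (proj₁ b) xor form r (proj₂ a) (proj₂ b))
  (Fin.remQuot-combine u x) (Fin.remQuot-combine v y)

form-sym : ∀ r x y → form r x y ≡ form r y x
form-sym zero    x y = refl
form-sym (suc r) x y = cong₂ _xor_ (det-sym (head r x) (head r y)) (form-sym r (tail r x) (tail r y))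

form-alternating : ∀ r x → form r x x ≡ false
form-alternating zero    x = refl
form-alternating (suc r) x = cong₂ _xor_ (det-alternating (head r x)) (form-alternating r (tail r x))

origin : ∀ r → V r
origin zero    = zero
origin (suc r) = combine {4} 0F (origin r)

form-origin : ∀ r x → form r (origin r) x ≡ false
form-origin zero    x = refl
form-origin (suc r) x with Fin.combine-surjective {4} {4 ^ r} x
... | u , x′ , refl = trans (form-combine r 0F (origin r) u x′) (form-origin r x′)

-- The binary digits of m, as first coordinates in the r hyperbolic planes.
isotropic : ∀ r → ℕ → V r
isotropic zero    m = zero
isotropic (suc r) m = combine ((m mod 2) ↑ˡ 2) (isotropic r (m / 2))

isotropic-0 : ∀ r → isotropic r 0 ≡ origin r
isotropic-0 zero    = refl
isotropic-0 (suc r) = cong (combine {4} 0F) (isotropic-0 r)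

form-isotropic : ∀ r m l → form r (isotropic r m) (isotropic r l) ≡ false
form-isotropic zero    m l = refl
form-isotropic (suc r) m l =
  trans (form-combine r ((m mod 2) ↑ˡ 2) (isotropic r (m / 2)) ((l mod 2) ↑ˡ 2) (isotropic r (l / 2)))
    (cong₂ _xor_ (det-bits (m mod 2) (l mod 2)) (form-isotropic r (m / 2) (l / 2)))
  where
  det-bits : ∀ (a b : Fin 2) → det (a ↑ˡ 2) (b ↑ˡ 2) ≡ false
  det-bits 0F 0F = refl
  det-bits 0F 1F = refl
  det-bits 1F 0F = refl
  det-bits 1F 1F = refl

isotropic-injective : ∀ r {m l} → m < 2 ^ r → l < 2 ^ r → isotropic r m ≡ isotropic r l → m ≡ l
isotropic-injective zero    (s≤s z≤n) (s≤s z≤n) _ = refl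
isotropic-injective (suc r) {m} {l} m< l< eq = begin
  m                      ≡⟨ m≡m%n+[m/n]*n m 2 ⟩
  m % 2 ℕ.+ m / 2 ℕ.* 2  ≡⟨ cong₂ (λ a b → a ℕ.+ b ℕ.* 2) bits rest ⟩
  l % 2 ℕ.+ l / 2 ℕ.* 2  ≡⟨ m≡m%n+[m/n]*n l 2 ⟨
  l                      ∎
  where
  open ≡-Reasoning
  split : (m mod 2) ↑ˡ 2 ≡ (l mod 2) ↑ˡ 2 × isotropic r (m / 2) ≡ isotropic r (l / 2)
  split = Fin.combine-injective ((m mod 2) ↑ˡ 2) (isotropic r (m / 2)) ((l mod 2) ↑ˡ 2) (isotropic r (l / 2)) eq
  bits : m % 2 ≡ l % 2
  bits = trans (sym (Fin.toℕ-fromℕ< (m%n<n m 2)))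
    (trans (cong toℕ (Fin.↑ˡ-injective 2 (m mod 2) (l mod 2) (proj₁ split))) (Fin.toℕ-fromℕ< (m%n<n l 2)))
  half : ∀ {m} → m < 2 ^ suc r → m / 2 < 2 ^ r
  half {m} m< = m<n*o⇒m/o<n (subst (m <_) (ℕ.*-comm 2 (2 ^ r)) m<)
  rest : m / 2 ≡ l / 2
  rest = isotropic-injective r (half m<) (half l<) (proj₂ split)

-- Realising a graph as a Gram matrix.

r+r≤2^r : ∀ r → suc r ℕ.+ suc r ≤ 2 ^ suc r
r+r≤2^r zero    = ℕ.≤-refl
r+r≤2^r (suc r) = begin
  suc (suc r) ℕ.+ suc (suc r)     ≡⟨ cong suc (ℕ.+-suc (suc r) (suc r)) ⟩
  2 ℕ.+ (suc r ℕ.+ suc r)         ≤⟨ ℕ.+-mono-≤ (ℕ.≤-trans (ℕ.+-mono-≤ (s≤s {n = r} z≤n) (s≤s {n = r} z≤n)) (r+r≤2^r r)) (r+r≤2^r r) ⟩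
  2 ^ suc r ℕ.+ 2 ^ suc r         ≡⟨ cong (2 ^ suc r ℕ.+_) (ℕ.+-identityʳ (2 ^ suc r)) ⟨
  2 ^ suc (suc r)                 ∎
  where open ℕ.≤-Reasoning

-- The conditions are relative to a list of vertices so that the recursion can discard vertices
-- without relabelling the rest.
record Embedding {n} (Δ : Graph n) (xs : List (Fin n)) (r : ℕ) : Set where
  field
    point     : Fin n → V r
    gram      : ∀ {i j} → i ∈ xs → j ∈ xs → form r (point i) (point j) ≡ Graph.adj Δ i j
    injective : ∀ {i j} → i ∈ xs → j ∈ xs → point i ≡ point j → i ≡ j
    nonzero   : ∀ {i} → i ∈ xs → point i ≢ origin r

module _ {n} (Δ : Graph n) (xs : List (Fin n)) where
  open Graph Δ

  embed-edgeless : ∀ r → length xs < suc r ℕ.+ suc r →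
                   (∀ {i j} → i ∈ xs → j ∈ xs → adj i j ≡ false) → Embedding Δ xs (suc r)
  embed-edgeless r small edgeless = record
    { point     = λ i → code (i ∈? xs)
    ; gram      = λ {i} {j} i∈ j∈ → trans (code-isotropic (i ∈? xs) (j ∈? xs)) (sym (edgeless i∈ j∈))
    ; injective = λ {i} {j} i∈ j∈ → code-injective (i ∈? xs) (j ∈? xs) i∈ j∈
    ; nonzero   = λ {i} i∈ → code-nonzero (i ∈? xs) i∈
    }
    where
    _∈?_ : ∀ i ys → Dec (i ∈ ys)
    _∈?_ = ∈?-by Fin._≟_
    index : ∀ {i} → Dec (i ∈ xs) → ℕ
    -- Positions are shifted by one because 0 codes the origin, which must be avoided; 0 is then the
    -- default outside `xs`, where nothing is claimed.
    index (yes i∈) = suc (toℕ (Any.index i∈))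
    index (no _)   = 0
    code : ∀ {i} → Dec (i ∈ xs) → V (suc r)
    code d = isotropic (suc r) (index d)
    code-isotropic : ∀ {i j} (d : Dec (i ∈ xs)) (d′ : Dec (j ∈ xs)) → form (suc r) (code d) (code d′) ≡ false
    code-isotropic d d′ = form-isotropic (suc r) (index d) (index d′)
    index-small : ∀ {i} (i∈ : i ∈ xs) → suc (toℕ (Any.index i∈)) < 2 ^ suc r
    -- There are fewer than 2(r + 1) ≤ 2^(r + 1) positions, so even after the shift each index names
    -- one of the vectors of the isotropic subspace.
    index-small i∈ = ℕ.≤-trans (s≤s (Fin.toℕ<n (Any.index i∈))) (ℕ.≤-trans small (r+r≤2^r r))
    code-injective : ∀ {i j} (d : Dec (i ∈ xs)) (d′ : Dec (j ∈ xs)) → i ∈ xs → j ∈ xs → code d ≡ code d′ → i ≡ j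
    code-injective (no i∉) _ i∈ _ _ = contradiction i∈ i∉
    code-injective (yes _) (no j∉) _ j∈ _ = contradiction j∈ j∉
    code-injective {i} {j} (yes p) (yes q) _ _ eq = trans (Any.lookup-index p)
      (trans (cong (lookup xs) (Fin.toℕ-injective (ℕ.suc-injective
        (isotropic-injective (suc r) (index-small p) (index-small q) eq)))) (sym (Any.lookup-index q)))
    code-nonzero : ∀ {i} (d : Dec (i ∈ xs)) → i ∈ xs → code d ≢ origin (suc r)
    code-nonzero (no i∉) i∈ _ = i∉ i∈
    code-nonzero (yes p) _ eq with isotropic-injective (suc r) (index-small p) (ℕ.m^n>0 2 (suc r))
      (trans eq (sym (isotropic-0 (suc r))))
    ... | ()

  module Pivot {a b : Fin n} (ab : adj a b ≡ true) where

    ba : adj b a ≡ true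
    ba = trans (symmetric b a) ab

    a≢b : a ≢ b
    a≢b refl with trans (sym ab) (loopless a)
    ... | ()

    -- With a and b sent to the basis (1,0), (0,1) of a hyperbolic plane, the Gram matrix
    -- forces the coordinates of every other vertex; reduced is the Gram matrix left over.
    coordinates : Fin n → Fin 4
    coordinates i = pair (adj i b) (adj i a)

    reduced : Graph n
    reduced = record
      { adj       = λ i j → adj i j xor det (coordinates i) (coordinates j)
      ; symmetric = λ i j → cong₂ _xor_ (symmetric i j) (det-sym (coordinates i) (coordinates j))
      ; loopless  = λ i → cong₂ _xor_ (loopless i) (det-alternating (coordinates i))
      }

    -- With coordinates (1,0) for `a`, the determinant reads off `adj j a`, which cancels `adj a j`.
    -- So `a` becomes isolated, and its component outside the new plane can be the origin.
    reduced-a : ∀ j → Graph.adj reduced a j ≡ false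
    reduced-a j = trans (cong (adj a j xor_) (trans (det-pair (adj a b) (adj a a) (adj j b) (adj j a))
      (trans (cong₂ (λ x y → (x ∧ adj j a) xor (y ∧ adj j b)) ab (loopless a))
        (trans (Bool.xor-identityʳ (adj j a)) (symmetric j a))))) (Bool.xor-same (adj a j))

    reduced-b : ∀ j → Graph.adj reduced b j ≡ false
    reduced-b j = trans (cong (adj b j xor_) (trans (det-pair (adj b b) (adj b a) (adj j b) (adj j a))
      (trans (cong₂ (λ x y → (x ∧ adj j a) xor (y ∧ adj j b)) (loopless b) ba)
        (symmetric j b)))) (Bool.xor-same (adj b j))

    ys : List (Fin n)
    ys = filter (λ i → ¬? (i Fin.≟ a)) (filter (λ i → ¬? (i Fin.≟ b)) xs)

    ys-shorter : a ∈ xs → b ∈ xs → 2 ℕ.+ length ys ≤ length xs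
    ys-shorter a∈ b∈ = ℕ.≤-trans
      (s≤s (filter-notAll (λ i → ¬? (i Fin.≟ a)) _ (lose (∈-filter⁺ (λ i → ¬? (i Fin.≟ b)) a∈ a≢b) (λ a≢a → a≢a refl))))
      (filter-notAll (λ i → ¬? (i Fin.≟ b)) xs (lose b∈ (λ b≢b → b≢b refl)))

    ∈ys : ∀ {i} → i ≢ a → i ≢ b → i ∈ xs → i ∈ ys
    ∈ys i≢a i≢b i∈ = ∈-filter⁺ (λ i → ¬? (i Fin.≟ a)) (∈-filter⁺ (λ i → ¬? (i Fin.≟ b)) i∈ i≢b) i≢a

    -- The vertices `a` and `b` lie wholly in the new plane, at (1,0) and (0,1), so they are
    -- distinct and nonzero. Every other vertex keeps a nonzero component outside the plane, which
    -- separates it from both; this is why `nonzero` is carried through the recursion.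
    extend : ∀ r → Embedding reduced ys r → Embedding Δ xs (suc r)
    extend r E = record
      { point     = λ i → combine (coordinates i) (rest i (i Fin.≟ a) (i Fin.≟ b))
      ; gram      = λ {i} {j} i∈ j∈ → begin
          form (suc r) (combine (coordinates i) (rest i (i Fin.≟ a) (i Fin.≟ b)))
                       (combine (coordinates j) (rest j (j Fin.≟ a) (j Fin.≟ b)))
            ≡⟨ form-combine r (coordinates i) _ (coordinates j) _ ⟩
          det (coordinates i) (coordinates j) xor form r (rest i (i Fin.≟ a) (i Fin.≟ b)) (rest j (j Fin.≟ a) (j Fin.≟ b))
            ≡⟨ cong (det (coordinates i) (coordinates j) xor_) (rest-gram i j (i Fin.≟ a) (i Fin.≟ b) (j Fin.≟ a) (j Fin.≟ b) i∈ j∈) ⟩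
          det (coordinates i) (coordinates j) xor (adj i j xor det (coordinates i) (coordinates j))
            ≡⟨ xor-cancel (det (coordinates i) (coordinates j)) (adj i j) ⟩
          adj i j ∎
      ; injective = λ {i} {j} i∈ j∈ eq →
          let ci≡cj , ri≡rj = Fin.combine-injective (coordinates i) _ (coordinates j) _ eq in
          rest-injective i j (i Fin.≟ a) (i Fin.≟ b) (j Fin.≟ a) (j Fin.≟ b) i∈ j∈ ci≡cj ri≡rj
      ; nonzero   = λ {i} i∈ eq →
          let ci≡0 , ri≡o = Fin.combine-injective (coordinates i) _ 0F (origin r) eq in
          rest-nonzero i (i Fin.≟ a) (i Fin.≟ b) i∈ ci≡0 ri≡o
      }
      where
      open ≡-Reasoning
      module E = Embedding E
      xor-cancel : ∀ x y → x xor (y xor x) ≡ y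
      xor-cancel false y = Bool.xor-identityʳ y
      xor-cancel true false = refl
      xor-cancel true true  = refl
      coordinates-a : coordinates a ≡ 1F
      coordinates-a = cong₂ pair ab (loopless a)
      coordinates-b : coordinates b ≡ 2F
      coordinates-b = cong₂ pair (loopless b) ba
      rest : ∀ i → Dec (i ≡ a) → Dec (i ≡ b) → V r
      rest i (no _) (no _) = E.point i
      rest i _      _      = origin r
      rest-gram : ∀ i j (ia : Dec (i ≡ a)) (ib : Dec (i ≡ b)) (ja : Dec (j ≡ a)) (jb : Dec (j ≡ b)) →
                  i ∈ xs → j ∈ xs → form r (rest i ia ib) (rest j ja jb) ≡ Graph.adj reduced i j
      rest-gram i j (yes refl) ib ja jb i∈ j∈ = trans (form-origin r _) (sym (reduced-a j))
      rest-gram i j (no _) (yes refl) ja jb i∈ j∈ = trans (form-origin r _) (sym (reduced-b j))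
      rest-gram i j (no i≢a) (no i≢b) (yes refl) jb i∈ j∈ = trans (form-sym r _ _)
        (trans (form-origin r _) (sym (trans (Graph.symmetric reduced i a) (reduced-a i))))
      rest-gram i j (no i≢a) (no i≢b) (no _) (yes refl) i∈ j∈ = trans (form-sym r _ _)
        (trans (form-origin r _) (sym (trans (Graph.symmetric reduced i b) (reduced-b i))))
      rest-gram i j (no i≢a) (no i≢b) (no j≢a) (no j≢b) i∈ j∈ = E.gram (∈ys i≢a i≢b i∈) (∈ys j≢a j≢b j∈)
      rest-injective : ∀ i j (ia : Dec (i ≡ a)) (ib : Dec (i ≡ b)) (ja : Dec (j ≡ a)) (jb : Dec (j ≡ b)) →
                       i ∈ xs → j ∈ xs → coordinates i ≡ coordinates j → rest i ia ib ≡ rest j ja jb → i ≡ j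
      rest-injective i j (yes refl) _ (yes refl) _ _ _ _ _ = refl
      rest-injective i j (yes refl) _ (no _) (yes refl) _ _ c _ with trans (sym coordinates-a) (trans c coordinates-b)
      ... | ()
      rest-injective i j (yes refl) _ (no j≢a) (no j≢b) _ j∈ _ eq = contradiction (sym eq) (E.nonzero (∈ys j≢a j≢b j∈))
      rest-injective i j (no _) (yes refl) (yes refl) _ _ _ c _ with trans (sym coordinates-a) (trans (sym c) coordinates-b)
      ... | ()
      rest-injective i j (no _) (yes refl) (no _) (yes refl) _ _ _ _ = refl
      rest-injective i j (no _) (yes refl) (no j≢a) (no j≢b) _ j∈ _ eq = contradiction (sym eq) (E.nonzero (∈ys j≢a j≢b j∈))
      rest-injective i j (no i≢a) (no i≢b) (yes _) _ i∈ _ _ eq = contradiction eq (E.nonzero (∈ys i≢a i≢b i∈))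
      rest-injective i j (no i≢a) (no i≢b) (no _) (yes _) i∈ _ _ eq = contradiction eq (E.nonzero (∈ys i≢a i≢b i∈))
      rest-injective i j (no i≢a) (no i≢b) (no j≢a) (no j≢b) i∈ j∈ _ eq = E.injective (∈ys i≢a i≢b i∈) (∈ys j≢a j≢b j∈) eq
      rest-nonzero : ∀ i (ia : Dec (i ≡ a)) (ib : Dec (i ≡ b)) → i ∈ xs → coordinates i ≡ 0F → rest i ia ib ≢ origin r
      rest-nonzero i (yes refl) _ _ c _ with trans (sym coordinates-a) c
      ... | ()
      rest-nonzero i (no _) (yes refl) _ c _ with trans (sym coordinates-b) c
      ... | ()
      rest-nonzero i (no i≢a) (no i≢b) i∈ _ eq = E.nonzero (∈ys i≢a i≢b i∈) eq

-- Each pivot removes two vertices and one plane, which preserves the bound. The bound is strict, so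
-- r = 0 never occurs and a plane is available in the edgeless case, even for an empty list.
embed : ∀ {n} r (Δ : Graph n) xs → length xs < r ℕ.+ r → Embedding Δ xs r
embed (suc r) Δ xs small with Any.any? (λ i → Any.any? (λ j → Graph.adj Δ i j Bool.≟ true) xs) xs
... | no edgeless = embed-edgeless Δ xs r small λ i∈ j∈ →
        Bool.¬-not λ ij → edgeless (lose i∈ (lose j∈ ij))
... | yes edge =
  let a , a∈ , edge-a = find edge
      b , b∈ , ab     = find edge-a
  in Pivot.extend Δ xs ab r (embed r (Pivot.reduced Δ xs ab) (Pivot.ys Δ xs ab)
       (ℕ.s≤s⁻¹ (ℕ.s≤s⁻¹ (ℕ.≤-trans (s≤s (Pivot.ys-shorter Δ xs ab a∈ b∈))
         (subst (length xs <_) (cong suc (ℕ.+-suc r r)) small)))))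

-- Sums of signs and orthogonality of characters.

ν-+ : ∀ m n → ν (m ℕ.+ n) ≡ ν m ℚ.+ ν n
ν-+ zero    n = sym (ℚ.+-identityˡ (ν n))
ν-+ (suc m) n = trans (cong (1ℚ ℚ.+_) (ν-+ m n)) (sym (ℚ.+-assoc 1ℚ (ν m) (ν n)))

ν-* : ∀ m n → ν (m ℕ.* n) ≡ ν m ℚ.* ν n
ν-* zero    n = sym (ℚ.*-zeroˡ (ν n))
ν-* (suc m) n = trans (ν-+ n (m ℕ.* n)) (trans (cong (ν n ℚ.+_) (ν-* m n))
  (solve 2 (λ a b → b :+ a :* b := (con 1ℚ :+ a) :* b) refl (ν m) (ν n)))
  where open +-*-Solver

ν-mono-< : ∀ {m n} → m < n → ν m ℚ.< ν n
ν-mono-< {zero}  {suc n} _         = ℚ.≤-<-trans (0≤ν n) (p<1+p (ν n))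
ν-mono-< {suc m} {suc n} (s≤s m<n) = ℚ.+-monoʳ-< 1ℚ (ν-mono-< m<n)

ν-injective : ∀ {m n} → ν m ≡ ν n → m ≡ n
ν-injective {m} {n} eq with ℕ.<-cmp m n
... | tri< m<n _ _ = contradiction eq (ℚ.<⇒≢ (ν-mono-< m<n))
... | tri≈ _ m≡n _ = m≡n
... | tri> _ _ n<m = contradiction (sym eq) (ℚ.<⇒≢ (ν-mono-< n<m))

sum-1≡ν : ∀ n → ℚΣ.sum {n} (λ _ → 1ℚ) ≡ ν n
sum-1≡ν zero    = refl
sum-1≡ν (suc n) = cong (1ℚ ℚ.+_) (sum-1≡ν n)

sum-++ : ∀ m {n} (u : Vector ℚ (m ℕ.+ n)) → ℚΣ.sum u ≡ ℚΣ.sum (λ i → u (i ↑ˡ n)) ℚ.+ ℚΣ.sum (λ j → u (m ↑ʳ j))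
sum-++ zero    u = sym (ℚ.+-identityˡ (ℚΣ.sum u))
sum-++ (suc m) u = trans (cong (u zero ℚ.+_) (sum-++ m (λ i → u (suc i)))) (sym (ℚ.+-assoc (u zero) _ _))

sum-combine : ∀ m {n} (u : Vector ℚ (m ℕ.* n)) → ℚΣ.sum u ≡ ℚΣ.sum {m} (λ i → ℚΣ.sum {n} (λ j → u (combine i j)))
sum-combine zero        u = refl
sum-combine (suc m) {n} u = trans (sum-++ n u) (cong (ℚΣ.sum (λ j → u (j ↑ˡ (m ℕ.* n))) ℚ.+_) (sum-combine m (λ k → u (n ↑ʳ k))))

sum-product : ∀ {m n} (u : Vector ℚ (m ℕ.* n)) (f : Vector ℚ m) (g : Vector ℚ n) →
              (∀ i j → u (combine i j) ≡ f i ℚ.* g j) → ℚΣ.sum u ≡ ℚΣ.sum f ℚ.* ℚΣ.sum g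
sum-product {m} {n} u f g u≡fg = begin
  ℚΣ.sum u                                     ≡⟨ sum-combine m u ⟩
  ℚΣ.sum (λ i → ℚΣ.sum (λ j → u (combine {m} {n} i j))) ≡⟨ ℚΣ.sum-cong {m} (λ i → trans (ℚΣ.sum-cong {n} (u≡fg i)) (sym (ℚΣ.*-distribˡ-sum {n} (f i) g))) ⟩
  ℚΣ.sum (λ i → f i ℚ.* ℚΣ.sum g)              ≡⟨ ℚΣ.*-distribʳ-sum {m} (ℚΣ.sum g) f ⟨
  ℚΣ.sum f ℚ.* ℚΣ.sum g                        ∎
  where open ≡-Reasoning

sum-bounded : ∀ {n} {u : Vector ℚ n} → (∀ i → u i ℚ.≤ 1ℚ ℚ.+ 1ℚ) → ℚΣ.sum u ℚ.≤ ν n ℚ.+ ν n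
sum-bounded {zero}      _   = ℚ.≤-refl
sum-bounded {suc n} {u} u≤2 = subst (ℚΣ.sum u ℚ.≤_)
  (solve 1 (λ a → (con 1ℚ :+ con 1ℚ) :+ (a :+ a) := (con 1ℚ :+ a) :+ (con 1ℚ :+ a)) refl (ν n))
  (ℚ.+-mono-≤ (u≤2 zero) (sum-bounded (λ i → u≤2 (suc i))))
  where open +-*-Solver

χ : Bool → ℚ
χ true  = ℚ.- 1ℚ
χ false = 1ℚ

χ-xor : ∀ a b → χ (a xor b) ≡ χ a ℚ.* χ b
χ-xor true  true  = refl
χ-xor true  false = refl
χ-xor false true  = refl
χ-xor false false = refl

χ² : ∀ a → χ a ℚ.* χ a ≡ 1ℚ
χ² true  = refl
χ² false = refl

-2ℚ : ℚ
-2ℚ = ℚ.- (1ℚ ℚ.+ 1ℚ)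

-- Every `true` turns a 1 into -1 and so costs 2. Applied to a row of an adjacency matrix, this ties
-- row sums of signs to valencies.
sum-χ : ∀ {n} (f : Fin n → Bool) → ℚΣ.sum (λ i → χ (f i)) ≡ ν n ℚ.+ -2ℚ ℚ.* ν ∣ Vec.tabulate f ∣
sum-χ {zero}  f = refl
sum-χ {suc n} f = trans (cong (χ (f zero) ℚ.+_) (sum-χ (λ i → f (suc i)))) (step (f zero))
  where
  open +-*-Solver
  ones : ℕ
  ones = ∣ Vec.tabulate (λ i → f (suc i)) ∣
  step : ∀ b → χ b ℚ.+ (ν n ℚ.+ -2ℚ ℚ.* ν ones) ≡ ν (suc n) ℚ.+ -2ℚ ℚ.* ν ∣ b ∷ Vec.tabulate (λ i → f (suc i)) ∣
  step true  = solve 2 (λ a b → con (χ true) :+ (a :+ con -2ℚ :* b) := (con 1ℚ :+ a) :+ con -2ℚ :* (con 1ℚ :+ b)) refl (ν n) (ν ones)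
  step false = sym (ℚ.+-assoc 1ℚ (ν n) (-2ℚ ℚ.* ν ones))

δ-combine : ∀ {m n} (i k : Fin m) (j l : Fin n) → δ (combine i j) (combine k l) ≡ δ i k ℚ.* δ j l
δ-combine i k j l = by-cases (i Fin.≟ k) (j Fin.≟ l)
  where
  by-cases : Dec (i ≡ k) → Dec (j ≡ l) → δ (combine i j) (combine k l) ≡ δ i k ℚ.* δ j l
  by-cases (yes refl) (yes refl) = trans (δ-diag (combine i j)) (sym (cong₂ ℚ._*_ (δ-diag i) (δ-diag j)))
  by-cases (yes refl) (no j≢l) = trans (δ-off (j≢l ∘ Fin.combine-injectiveʳ i j k l))
    (sym (trans (cong (δ i i ℚ.*_) (δ-off j≢l)) (ℚ.*-zeroʳ (δ i i))))
  by-cases (no i≢k) _ = trans (δ-off (i≢k ∘ Fin.combine-injectiveˡ i j k l))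
    (sym (trans (cong (ℚ._* δ j l) (δ-off i≢k)) (ℚ.*-zeroˡ (δ j l))))

character : ∀ r → V r → V r → ℚ
character r x y = χ (form r x y)

det-orthogonal : ∀ a b → ℚΣ.sum (λ u → χ (det a u) ℚ.* χ (det u b)) ≡ ν 4 ℚ.* δ a b
det-orthogonal 0F 0F = refl
det-orthogonal 0F 1F = refl
det-orthogonal 0F 2F = refl
det-orthogonal 0F 3F = refl
det-orthogonal 1F 0F = refl
det-orthogonal 1F 1F = refl
det-orthogonal 1F 2F = refl
det-orthogonal 1F 3F = refl
det-orthogonal 2F 0F = refl
det-orthogonal 2F 1F = refl
det-orthogonal 2F 2F = refl
det-orthogonal 2F 3F = refl
det-orthogonal 3F 0F = refl
det-orthogonal 3F 1F = refl
det-orthogonal 3F 2F = refl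
det-orthogonal 3F 3F = refl

-- The matrix is the r-fold Kronecker power of the 4 by 4 sign matrix of `det`, so the sum factors
-- plane by plane into finite checks.
character-orthogonal : ∀ r x y → ℚΣ.sum (λ z → character r x z ℚ.* character r z y) ≡ ν (4 ^ r) ℚ.* δ x y
character-orthogonal zero    0F 0F = refl
character-orthogonal (suc r) x y with Fin.combine-surjective {4} {4 ^ r} x | Fin.combine-surjective {4} {4 ^ r} y
... | a , x′ , refl | b , y′ , refl = begin
  ℚΣ.sum (λ z → character (suc r) (combine a x′) z ℚ.* character (suc r) z (combine b y′))
    ≡⟨ sum-product {4} {4 ^ r} (λ z → character (suc r) (combine a x′) z ℚ.* character (suc r) z (combine b y′))
         (λ u → χ (det a u) ℚ.* χ (det u b)) (λ z → character r x′ z ℚ.* character r z y′) factor ⟩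
  ℚΣ.sum (λ u → χ (det a u) ℚ.* χ (det u b)) ℚ.* ℚΣ.sum (λ z → character r x′ z ℚ.* character r z y′)
    ≡⟨ cong₂ ℚ._*_ (det-orthogonal a b) (character-orthogonal r x′ y′) ⟩
  (ν 4 ℚ.* δ a b) ℚ.* (ν (4 ^ r) ℚ.* δ x′ y′)
    ≡⟨ solve 4 (λ p q s t → (p :* q) :* (s :* t) := (p :* s) :* (q :* t)) refl (ν 4) (δ a b) (ν (4 ^ r)) (δ x′ y′) ⟩
  (ν 4 ℚ.* ν (4 ^ r)) ℚ.* (δ a b ℚ.* δ x′ y′)
    ≡⟨ cong₂ ℚ._*_ (ν-* 4 (4 ^ r)) (δ-combine a b x′ y′) ⟨
  ν (4 ^ suc r) ℚ.* δ (combine a x′) (combine b y′) ∎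
  where
  open +-*-Solver
  open ≡-Reasoning
  factor : ∀ u z → character (suc r) (combine a x′) (combine u z) ℚ.* character (suc r) (combine u z) (combine b y′)
                 ≡ (χ (det a u) ℚ.* χ (det u b)) ℚ.* (character r x′ z ℚ.* character r z y′)
  factor u z = trans
    (cong₂ ℚ._*_ (trans (cong χ (form-combine r a x′ u z)) (χ-xor (det a u) (form r x′ z)))
                 (trans (cong χ (form-combine r u z b y′)) (χ-xor (det u b) (form r z y′))))
    (solve 4 (λ p q s t → (p :* q) :* (s :* t) := (p :* s) :* (q :* t)) refl
      (χ (det a u)) (character r x′ z) (χ (det u b)) (character r z y′))

-- The switched graph: row sums and connectedness.

module Construction {n} (Δ : Graph n) (r : ℕ) (E : Embedding Δ (allFin n) r) where

  open Embedding E renaming (point to w)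

  w-gram : ∀ i j → form r (w i) (w j) ≡ Graph.adj Δ i j
  w-gram i j = gram (∈-allFin i) (∈-allFin j)

  w-injective : ∀ {i j} → w i ≡ w j → i ≡ j
  w-injective = injective (∈-allFin _) (∈-allFin _)

  w≢origin : ∀ i → w i ≢ origin r
  w≢origin i = nonzero (∈-allFin i)

  marked? : ∀ x → Dec (∃[ i ] w i ≡ x)
  marked? x = Fin.any? (λ i → w i Fin.≟ x)

  marked : V r → Bool
  marked x = does (marked? x)

  marked-w : ∀ i → marked (w i) ≡ true
  marked-w i = dec-true (marked? (w i)) (i , refl)

  marked-origin : marked (origin r) ≡ false
  marked-origin = dec-false (marked? (origin r)) (λ (i , eq) → w≢origin i eq)

  Γ : Graph (4 ^ r)
  Γ = record
    { adj       = λ x y → form r x y xor (marked x xor marked y)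
    ; symmetric = λ x y → cong₂ _xor_ (form-sym r x y) (Bool.xor-comm (marked x) (marked y))
    ; loopless  = λ x → cong₂ _xor_ (form-alternating r x) (Bool.xor-same (marked x))
    }

  open Graph Γ using (adj; Adjacent; valency)

  adj-w : ∀ i j → adj (w i) (w j) ≡ Graph.adj Δ i j
  adj-w i j = trans (cong₂ _xor_ (w-gram i j) (cong₂ _xor_ (marked-w i) (marked-w j))) (Bool.xor-identityʳ _)

  N : ℚ
  N = ν (4 ^ r)

  H : V r → V r → ℚ
  H x y = χ (adj x y)

  H-sym : ∀ x y → H x y ≡ H y x
  H-sym x y = cong χ (Graph.symmetric Γ x y)

  H-unit : ∀ x y → H x y ℚ.* H x y ≡ 1ℚ
  H-unit x y = χ² (adj x y)

  H-diag : ∀ x → H x x ≡ 1ℚ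
  H-diag x = cong χ (Graph.loopless Γ x)

  φ : V r → ℚ
  φ x = χ (marked x)

  H≡ : ∀ x y → H x y ≡ character r x y ℚ.* (φ x ℚ.* φ y)
  H≡ x y = trans (χ-xor (form r x y) (marked x xor marked y)) (cong (character r x y ℚ.*_) (χ-xor (marked x) (marked y)))

  -- The sign `φ z` occurs twice and cancels; the outer sign `φ x ℚ.* φ y` is 1 on the diagonal, and
  -- off the diagonal the sum it multiplies is 0.
  H-orth : ∀ x y → ℚΣ.sum (λ z → H x z ℚ.* H z y) ≡ N ℚ.* δ x y
  H-orth x y = begin
    ℚΣ.sum (λ z → H x z ℚ.* H z y)
      ≡⟨ ℚΣ.sum-cong {4 ^ r} (λ z → trans (cong₂ ℚ._*_ (H≡ x z) (H≡ z y))
           (trans (solve 5 (λ p a c b q → (p :* (a :* c)) :* (q :* (c :* b)) := (c :* c) :* ((a :* b) :* (p :* q))) refl (character r x z) (φ x) (φ z) (φ y) (character r z y))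
             (trans (cong (ℚ._* ((φ x ℚ.* φ y) ℚ.* (character r x z ℚ.* character r z y))) (χ² (marked z))) (ℚ.*-identityˡ _)))) ⟩
    ℚΣ.sum (λ z → (φ x ℚ.* φ y) ℚ.* (character r x z ℚ.* character r z y))
      ≡⟨ ℚΣ.*-distribˡ-sum {4 ^ r} (φ x ℚ.* φ y) (λ z → character r x z ℚ.* character r z y) ⟨
    (φ x ℚ.* φ y) ℚ.* ℚΣ.sum (λ z → character r x z ℚ.* character r z y)
      ≡⟨ cong ((φ x ℚ.* φ y) ℚ.*_) (character-orthogonal r x y) ⟩
    (φ x ℚ.* φ y) ℚ.* (N ℚ.* δ x y)
      ≡⟨ signs (x Fin.≟ y) ⟩
    N ℚ.* δ x y ∎
    where
    open +-*-Solver
    open ≡-Reasoning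
    signs : Dec (x ≡ y) → (φ x ℚ.* φ y) ℚ.* (N ℚ.* δ x y) ≡ N ℚ.* δ x y
    signs (yes refl) = trans (cong (ℚ._* (N ℚ.* δ x x)) (χ² (marked x))) (ℚ.*-identityˡ _)
    signs (no x≢y)   = trans (cong (λ t → (φ x ℚ.* φ y) ℚ.* (N ℚ.* t)) (δ-off x≢y))
      (trans (solve 2 (λ a N → a :* (N :* con 0ℚ) := N :* con 0ℚ) refl (φ x ℚ.* φ y) N) (cong (N ℚ.*_) (sym (δ-off x≢y))))

  -- Injectivity of `w` is what makes the sum of deltas an indicator: no marked vector is counted
  -- twice.
  φ≡ : ∀ y → φ y ≡ 1ℚ ℚ.+ -2ℚ ℚ.* ℚΣ.sum (λ i → δ (w i) y)
  φ≡ y = by-cases (marked? y)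
    where
    by-cases : (d : Dec (∃[ i ] w i ≡ y)) → χ (does d) ≡ 1ℚ ℚ.+ -2ℚ ℚ.* ℚΣ.sum (λ i → δ (w i) y)
    by-cases (yes (i₀ , refl)) = sym (cong (λ t → 1ℚ ℚ.+ -2ℚ ℚ.* t) (trans (ℚΣ.sum-cong {n} same)
      (trans (ℚΣ.sum-cong {n} (λ i → sym (ℚ.*-identityʳ (δ i₀ i)))) (ℚΣ.sum-δ i₀ (λ _ → 1ℚ)))))
      where
      same : ∀ i → δ (w i) (w i₀) ≡ δ i₀ i
      same i with i₀ Fin.≟ i
      ... | yes refl = δ-diag (w i)
      ... | no  i₀≢i = δ-off (i₀≢i ∘ sym ∘ w-injective)
    by-cases (no unmarked) = sym (cong (λ t → 1ℚ ℚ.+ -2ℚ ℚ.* t)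
      (trans (ℚΣ.sum-cong {n} (λ i → δ-off (λ eq → unmarked (i , eq)))) (ℚΣ.sum-replicate-zero n)))

  h : V r → ℚ
  h x = ℚΣ.sum (H x)

  -- Before switching, row `x` is a character, with sum N at the origin and 0 elsewhere. Negating
  -- the column of each `w i` subtracts twice its entry, and negating the row contributes `φ x`.
  h≡ : ∀ x → h x ≡ φ x ℚ.* (N ℚ.* δ x (origin r) ℚ.+ -2ℚ ℚ.* ℚΣ.sum (λ i → character r x (w i)))
  h≡ x = begin
    ℚΣ.sum (H x)
      ≡⟨ ℚΣ.sum-cong {4 ^ r} (λ y → trans (H≡ x y) (trans (cong (λ t → character r x y ℚ.* (φ x ℚ.* t)) (φ≡ y))
           (solve 3 (λ c f t → c :* (f :* (con 1ℚ :+ con -2ℚ :* t)) := f :* (con 1ℚ :* (c :* con 1ℚ) :+ con -2ℚ :* (c :* t))) refl (character r x y) (φ x) _))) ⟩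
    ℚΣ.sum (λ y → φ x ℚ.* (1ℚ ℚ.* (character r x y ℚ.* 1ℚ) ℚ.+ -2ℚ ℚ.* (character r x y ℚ.* ℚΣ.sum (λ i → δ (w i) y))))
      ≡⟨ ℚΣ.*-distribˡ-sum {4 ^ r} (φ x) _ ⟨
    φ x ℚ.* ℚΣ.sum (λ y → 1ℚ ℚ.* (character r x y ℚ.* 1ℚ) ℚ.+ -2ℚ ℚ.* (character r x y ℚ.* ℚΣ.sum (λ i → δ (w i) y)))
      ≡⟨ cong (φ x ℚ.*_) (ℚΣ.sum-linear {4 ^ r} 1ℚ -2ℚ _ _) ⟩
    φ x ℚ.* (1ℚ ℚ.* ℚΣ.sum (λ y → character r x y ℚ.* 1ℚ) ℚ.+ -2ℚ ℚ.* ℚΣ.sum (λ y → character r x y ℚ.* ℚΣ.sum (λ i → δ (w i) y)))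
      ≡⟨ cong (φ x ℚ.*_) (cong₂ (λ a b → a ℚ.+ -2ℚ ℚ.* b) (trans (ℚ.*-identityˡ _) total) pick) ⟩
    φ x ℚ.* (N ℚ.* δ x (origin r) ℚ.+ -2ℚ ℚ.* ℚΣ.sum (λ i → character r x (w i))) ∎
    where
    open +-*-Solver
    open ≡-Reasoning
    -- The all-ones vector is the column of the origin, so this is an instance of orthogonality.
    total : ℚΣ.sum (λ y → character r x y ℚ.* 1ℚ) ≡ N ℚ.* δ x (origin r)
    total = trans (ℚΣ.sum-cong {4 ^ r} (λ y → cong (λ b → character r x y ℚ.* χ b) (sym (trans (form-sym r y (origin r)) (form-origin r y)))))
      (character-orthogonal r x (origin r))
    pick : ℚΣ.sum (λ y → character r x y ℚ.* ℚΣ.sum (λ i → δ (w i) y)) ≡ ℚΣ.sum (λ i → character r x (w i))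
    pick = begin
      ℚΣ.sum (λ y → character r x y ℚ.* ℚΣ.sum (λ i → δ (w i) y))
        ≡⟨ ℚΣ.sum-cong {4 ^ r} (λ y → ℚΣ.*-distribˡ-sum {n} (character r x y) (λ i → δ (w i) y)) ⟩
      ℚΣ.sum (λ y → ℚΣ.sum (λ i → character r x y ℚ.* δ (w i) y))
        ≡⟨ ℚΣ.∑-comm {4 ^ r} {n} (λ y i → character r x y ℚ.* δ (w i) y) ⟩
      ℚΣ.sum (λ i → ℚΣ.sum (λ y → character r x y ℚ.* δ (w i) y))
        ≡⟨ ℚΣ.sum-cong {n} (λ i → trans (ℚΣ.sum-cong {4 ^ r} (λ y → ℚ.*-comm (character r x y) (δ (w i) y))) (ℚΣ.sum-δ (w i) (character r x))) ⟩
      ℚΣ.sum (λ i → character r x (w i)) ∎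

  h-valency : ∀ x → h x ≡ N ℚ.+ -2ℚ ℚ.* ν (valency x)
  h-valency x = sum-χ (adj x)

  -- At a marked vector the sign is -1 and, the vector being nonzero, the N term vanishes; what
  -- remains is twice a row sum of signs of Δ, by the Gram condition.
  h-w : ∀ i → h (w i) ≡ (1ℚ ℚ.+ 1ℚ) ℚ.* (ν n ℚ.+ -2ℚ ℚ.* ν (Graph.valency Δ i))
  h-w i = begin
    h (w i)
      ≡⟨ h≡ (w i) ⟩
    φ (w i) ℚ.* (N ℚ.* δ (w i) (origin r) ℚ.+ -2ℚ ℚ.* ℚΣ.sum (λ j → character r (w i) (w j)))
      ≡⟨ cong₂ (λ a b → χ a ℚ.* (N ℚ.* b ℚ.+ -2ℚ ℚ.* ℚΣ.sum (λ j → character r (w i) (w j)))) (marked-w i) (δ-off (w≢origin i)) ⟩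
    χ true ℚ.* (N ℚ.* 0ℚ ℚ.+ -2ℚ ℚ.* ℚΣ.sum (λ j → character r (w i) (w j)))
      ≡⟨ solve 2 (λ N s → con (χ true) :* (N :* con 0ℚ :+ con -2ℚ :* s) := (con 1ℚ :+ con 1ℚ) :* s) refl N (ℚΣ.sum (λ j → character r (w i) (w j))) ⟩
    (1ℚ ℚ.+ 1ℚ) ℚ.* ℚΣ.sum (λ j → character r (w i) (w j))
      ≡⟨ cong ((1ℚ ℚ.+ 1ℚ) ℚ.*_) (trans (ℚΣ.sum-cong {n} (λ j → cong χ (w-gram i j))) (sum-χ (Graph.adj Δ i))) ⟩
    (1ℚ ℚ.+ 1ℚ) ℚ.* (ν n ℚ.+ -2ℚ ℚ.* ν (Graph.valency Δ i)) ∎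
    where
    open +-*-Solver
    open ≡-Reasoning

  h-w-injective : ∀ i j → h (w i) ≡ h (w j) → Graph.valency Δ i ≡ Graph.valency Δ j
  h-w-injective i j eq = ν-injective (begin
    ν (Graph.valency Δ i)   ≡⟨ recover (ν (Graph.valency Δ i)) ⟩
    recovered (h′ (ν (Graph.valency Δ i)))   ≡⟨ cong recovered (trans (sym (h-w i)) (trans eq (h-w j))) ⟩
    recovered (h′ (ν (Graph.valency Δ j)))   ≡⟨ recover (ν (Graph.valency Δ j)) ⟨
    ν (Graph.valency Δ j)   ∎)
    where
    open +-*-Solver
    open ≡-Reasoning
    h′ recovered : ℚ → ℚ
    h′ k = (1ℚ ℚ.+ 1ℚ) ℚ.* (ν n ℚ.+ -2ℚ ℚ.* k)
    recovered t = ½ ℚ.* (ν n ℚ.- ½ ℚ.* t)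
    recover : ∀ k → k ≡ recovered (h′ k)
    recover k = solve 2 (λ n k → k := con ½ :* (n :- con ½ :* ((con 1ℚ :+ con 1ℚ) :* (n :+ con -2ℚ :* k)))) refl (ν n) k

  valency-w-injective : ∀ i j → valency (w i) ≡ valency (w j) → Graph.valency Δ i ≡ Graph.valency Δ j
  valency-w-injective i j eq = h-w-injective i j
    (trans (h-valency (w i)) (trans (cong (λ k → N ℚ.+ -2ℚ ℚ.* ν k) eq) (sym (h-valency (w j)))))

  -- Away from the origin only the `n` switched columns contribute, each ±2. This makes all nonzero
  -- vertices have valency close to half of N.
  h-bounded : ∀ x → x ≢ origin r → h x ℚ.≤ ν n ℚ.+ ν n
  h-bounded x x≢o = subst (ℚ._≤ ν n ℚ.+ ν n) (sym h≡′) (sum-bounded (λ i → two (marked x) (form r x (w i))))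
    where
    open +-*-Solver
    h≡′ : h x ≡ ℚΣ.sum (λ i → (φ x ℚ.* -2ℚ) ℚ.* character r x (w i))
    h≡′ = trans (h≡ x) (trans (cong (λ t → φ x ℚ.* (N ℚ.* t ℚ.+ -2ℚ ℚ.* ℚΣ.sum (λ i → character r x (w i)))) (δ-off x≢o))
      (trans (solve 3 (λ f N s → f :* (N :* con 0ℚ :+ con -2ℚ :* s) := (f :* con -2ℚ) :* s) refl (φ x) N (ℚΣ.sum (λ i → character r x (w i))))
        (ℚΣ.*-distribˡ-sum {n} (φ x ℚ.* -2ℚ) (λ i → character r x (w i)))))
    two : ∀ a b → (χ a ℚ.* -2ℚ) ℚ.* χ b ℚ.≤ 1ℚ ℚ.+ 1ℚ
    two true  true  = ℚ.≤ᵇ⇒≤ _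
    two true  false = ℚ.≤ᵇ⇒≤ _
    two false true  = ℚ.≤ᵇ⇒≤ _
    two false false = ℚ.≤ᵇ⇒≤ _

  module _ (4n<N : (ν n ℚ.+ ν n) ℚ.+ (ν n ℚ.+ ν n) ℚ.< N) where

    -- Otherwise Σ (1 - H x z) (1 - H y z) = 0 over z, that is N = h x + h y ≤ 4 n.
    common-neighbour : ∀ x y → x ≢ origin r → y ≢ origin r → x ≢ y → ∃[ z ] (Adjacent x z × Adjacent y z)
    common-neighbour x y x≢o y≢o x≢y = decide (Fin.any? (λ z → (adj x z Bool.≟ true) ×-dec (adj y z Bool.≟ true)))
      where
      open +-*-Solver
      open ≡-Reasoning
      no-common : ∀ a b → ¬ (a ≡ true × b ≡ true) → 1ℚ ≡ 1ℚ ℚ.* (1ℚ ℚ.* χ a ℚ.+ 1ℚ ℚ.* χ b) ℚ.+ (ℚ.- 1ℚ) ℚ.* (χ a ℚ.* χ b)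
      no-common true  true  none = contradiction (refl , refl) none
      no-common true  false _    = refl
      no-common false true  _    = refl
      no-common false false _    = refl
      decide : Dec (∃[ z ] (Adjacent x z × Adjacent y z)) → ∃[ z ] (Adjacent x z × Adjacent y z)
      decide (yes found) = found
      decide (no none) = contradiction 4n<N (λ lt → ℚ.<-irrefl N≡ (ℚ.≤-<-trans (ℚ.+-mono-≤ (h-bounded x x≢o) (h-bounded y y≢o)) lt))
        where
        N≡ : h x ℚ.+ h y ≡ N
        N≡ = sym (begin
          N
            ≡⟨ sum-1≡ν (4 ^ r) ⟨
          ℚΣ.sum {4 ^ r} (λ _ → 1ℚ)
            ≡⟨ ℚΣ.sum-cong {4 ^ r} (λ z → no-common (adj x z) (adj y z) (λ common → none (z , common))) ⟩
          ℚΣ.sum (λ z → 1ℚ ℚ.* (1ℚ ℚ.* H x z ℚ.+ 1ℚ ℚ.* H y z) ℚ.+ (ℚ.- 1ℚ) ℚ.* (H x z ℚ.* H y z))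
            ≡⟨ ℚΣ.sum-linear {4 ^ r} 1ℚ (ℚ.- 1ℚ) _ _ ⟩
          1ℚ ℚ.* ℚΣ.sum (λ z → 1ℚ ℚ.* H x z ℚ.+ 1ℚ ℚ.* H y z) ℚ.+ (ℚ.- 1ℚ) ℚ.* ℚΣ.sum (λ z → H x z ℚ.* H y z)
            ≡⟨ cong₂ (λ a b → 1ℚ ℚ.* a ℚ.+ (ℚ.- 1ℚ) ℚ.* b) (ℚΣ.sum-linear {4 ^ r} 1ℚ 1ℚ (H x) (H y))
                 (trans (ℚΣ.sum-cong {4 ^ r} (λ z → cong (H x z ℚ.*_) (H-sym y z))) (trans (H-orth x y) (cong (N ℚ.*_) (δ-off x≢y)))) ⟩
          1ℚ ℚ.* (1ℚ ℚ.* h x ℚ.+ 1ℚ ℚ.* h y) ℚ.+ (ℚ.- 1ℚ) ℚ.* (N ℚ.* 0ℚ)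
            ≡⟨ solve 3 (λ a b N → con 1ℚ :* (con 1ℚ :* a :+ con 1ℚ :* b) :+ (:- con 1ℚ) :* (N :* con 0ℚ) := a :+ b) refl (h x) (h y) N ⟩
          h x ℚ.+ h y ∎)

    nonzero-path : ∀ x y → x ≢ origin r → y ≢ origin r → Star Adjacent x y
    nonzero-path x y x≢o y≢o = decide (x Fin.≟ y)
      where
      decide : Dec (x ≡ y) → Star Adjacent x y
      decide (yes refl) = Star.ε
      decide (no x≢y) = let z , xz , yz = common-neighbour x y x≢o y≢o x≢y in
        xz ◅ trans (Graph.symmetric Γ z y) yz ◅ Star.ε

    -- The origin has to be treated apart, since its row sum is large. Its row of the form is zero
    -- and it is unmarked, so it is adjacent to every marked vector, and a vertex `i` of Δ supplies
    -- the bridge `w i`.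
    connected : Fin n → Connected Γ
    connected i = ℕ.m^n>0 4 r , λ x y → path x y (x Fin.≟ origin r) (y Fin.≟ origin r)
      where
      o-w : Adjacent (origin r) (w i)
      o-w = cong₂ _xor_ (form-origin r (w i)) (cong₂ _xor_ marked-origin (marked-w i))
      w-o : Adjacent (w i) (origin r)
      w-o = trans (Graph.symmetric Γ (w i) (origin r)) o-w
      path : ∀ x y → Dec (x ≡ origin r) → Dec (y ≡ origin r) → Star Adjacent x y
      path x y (yes refl) (yes refl) = Star.ε
      path x y (yes refl) (no y≢o)   = o-w ◅ nonzero-path (w i) y (w≢origin i) y≢o
      path x y (no x≢o)   (yes refl) = nonzero-path x (w i) x≢o (w≢origin i) ◅◅ (w-o ◅ Star.ε)
      path x y (no x≢o)   (no y≢o)   = nonzero-path x y x≢o y≢o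

-- Counting distinct valencies.

lookup-injective : ∀ {xs : List ℕ} → Unique xs → ∀ {i j} → lookup xs i ≡ lookup xs j → i ≡ j
lookup-injective (x∉ ∷ xs!) {zero}  {zero}  _  = refl
lookup-injective (x∉ ∷ xs!) {zero}  {suc j} eq = contradiction eq (All.lookup x∉ (∈-lookup j))
lookup-injective (x∉ ∷ xs!) {suc i} {zero}  eq = contradiction (sym eq) (All.lookup x∉ (∈-lookup i))
lookup-injective (x∉ ∷ xs!) {suc i} {suc j} eq = cong suc (lookup-injective xs! eq)

module _ {n} (Δ : Graph n) where
  open Graph Δ using (valency; distinctValencies)

  representative : ∀ k → ∃[ i ] lookup distinctValencies k ≡ valency i
  representative k =
    let i , _ , eq = ∈-map⁻ valency (∈-deduplicate⁻ ℕ._≟_ (map valency (allFin n)) (∈-lookup k)) in i , eq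

  representative-injective : ∀ {k l} → valency (proj₁ (representative k)) ≡ valency (proj₁ (representative l)) → k ≡ l
  representative-injective {k} {l} eq = lookup-injective (deduplicate-! (map valency (allFin n)))
    (trans (proj₂ (representative k)) (trans eq (sym (proj₂ (representative l)))))

  #valencies≤n : #valencies Δ ≤ n
  #valencies≤n = Fin.injective⇒≤ {f = λ k → proj₁ (representative k)} (representative-injective ∘ cong valency)

  -- Valencies may change under `w`; only their distinctness has to survive. Each valency of Δ is
  -- sent to the position, among those of Γ, of the valency at the image of a representative; this
  -- injection of finite index sets compares the lengths.
  #valencies-mono : ∀ {m} (Γ : Graph m) (w : Fin n → Fin m) →
                    (∀ i j → Graph.valency Γ (w i) ≡ Graph.valency Γ (w j) → valency i ≡ valency j) →
                    #valencies Δ ≤ #valencies Γ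
  #valencies-mono {m} Γ w reflects = Fin.injective⇒≤ {f = λ k → Any.index (found k)} λ {k} {l} eq →
    representative-injective (reflects _ _ (trans (Any.lookup-index (found k))
      (trans (cong (lookup (Graph.distinctValencies Γ)) eq) (sym (Any.lookup-index (found l))))))
    where
    found : ∀ k → Graph.valency Γ (w (proj₁ (representative k))) ∈ Graph.distinctValencies Γ
    found k = ∈-deduplicate⁺ ℕ._≟_ (∈-map⁺ (Graph.valency Γ) (∈-allFin (w (proj₁ (representative k)))))

-- The dimension and its numerical bounds.

2n+1<4^n : ∀ h → suc (suc h ℕ.+ suc h) < 4 ^ suc h
2n+1<4^n zero    = ℕ.≤-refl
2n+1<4^n (suc h) = begin-strict
  suc (suc (suc h) ℕ.+ suc (suc h))         ≡⟨ cong (2 ℕ.+_) (ℕ.+-suc (suc h) (suc h)) ⟩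
  2 ℕ.+ suc (suc h ℕ.+ suc h)               <⟨ ℕ.+-mono-≤-< (ℕ.≤-trans (s≤s (s≤s z≤n)) (2n+1<4^n h)) (2n+1<4^n h) ⟩
  4 ^ suc h ℕ.+ 4 ^ suc h                   ≤⟨ ℕ.+-monoʳ-≤ (4 ^ suc h) (ℕ.m≤m+n (4 ^ suc h) _) ⟩
  4 ^ suc (suc h)                           ∎
  where open ℕ.≤-Reasoning

module _ (n : ℕ) where

  n≤1+h+h : n ≤ suc (⌊ n /2⌋ ℕ.+ ⌊ n /2⌋)
  n≤1+h+h = begin
    n                              ≡⟨ ℕ.⌊n/2⌋+⌈n/2⌉≡n n ⟨
    ⌊ n /2⌋ ℕ.+ ⌈ n /2⌉            ≤⟨ ℕ.+-monoʳ-≤ ⌊ n /2⌋ (ℕ.⌊n/2⌋-mono (ℕ.n≤1+n (suc n))) ⟩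
    ⌊ n /2⌋ ℕ.+ suc ⌊ n /2⌋        ≡⟨ ℕ.+-suc ⌊ n /2⌋ ⌊ n /2⌋ ⟩
    suc (⌊ n /2⌋ ℕ.+ ⌊ n /2⌋)      ∎
    where open ℕ.≤-Reasoning

  -- The least r with n < 2r, as the embedding demands. Then 4ʳ = 2^(2⌊n/2⌋ + 2), which is the
  -- origin of the bound 2ⁿ⁺².
  dimension : ℕ
  dimension = suc ⌊ n /2⌋

  n<dimension+dimension : n < dimension ℕ.+ dimension
  n<dimension+dimension = subst (n <_) (cong suc (sym (ℕ.+-suc ⌊ n /2⌋ ⌊ n /2⌋))) (s≤s n≤1+h+h)

  size-bound : 4 ^ dimension ≤ 2 ^ (n ℕ.+ 2)
  size-bound = subst (_≤ 2 ^ (n ℕ.+ 2)) (sym (ℕ.^-*-assoc 2 2 dimension)) (ℕ.^-monoʳ-≤ 2 (begin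
    2 ℕ.* dimension                  ≡⟨ ℕ.*-distribˡ-+ 2 1 ⌊ n /2⌋ ⟩
    2 ℕ.+ 2 ℕ.* ⌊ n /2⌋              ≡⟨ cong (λ k → 2 ℕ.+ (⌊ n /2⌋ ℕ.+ k)) (ℕ.+-identityʳ ⌊ n /2⌋) ⟩
    2 ℕ.+ (⌊ n /2⌋ ℕ.+ ⌊ n /2⌋)      ≤⟨ ℕ.+-monoʳ-≤ 2 (ℕ.+-monoʳ-≤ ⌊ n /2⌋ (ℕ.⌊n/2⌋≤⌈n/2⌉ n)) ⟩
    2 ℕ.+ (⌊ n /2⌋ ℕ.+ ⌈ n /2⌉)      ≡⟨ cong (2 ℕ.+_) (ℕ.⌊n/2⌋+⌈n/2⌉≡n n) ⟩
    2 ℕ.+ n                          ≡⟨ ℕ.+-comm 2 n ⟩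
    n ℕ.+ 2                          ∎))
    where open ℕ.≤-Reasoning

  -- One factor 4 of the size absorbs the 4 of 4n, leaving n < 4^⌊n/2⌋. This follows from n ≤ 2⌊n/2⌋
  -- + 1 once ⌊n/2⌋ is positive, which 3 ≤ n guarantees.
  4n<size : 3 ≤ n → (ν n ℚ.+ ν n) ℚ.+ (ν n ℚ.+ ν n) ℚ.< ν (4 ^ dimension)
  4n<size 3≤n = subst (ℚ._< ν (4 ^ dimension)) (trans (ν-+ (n ℕ.+ n) (n ℕ.+ n)) (cong₂ ℚ._+_ (ν-+ n n) (ν-+ n n)))
    (ν-mono-< (begin-strict
      (n ℕ.+ n) ℕ.+ (n ℕ.+ n)   ≡⟨ ℕ.+-assoc n n (n ℕ.+ n) ⟩
      n ℕ.+ (n ℕ.+ (n ℕ.+ n))   ≡⟨ cong (λ k → n ℕ.+ (n ℕ.+ (n ℕ.+ k))) (ℕ.+-identityʳ n) ⟨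
      4 ℕ.* n                   <⟨ ℕ.*-monoʳ-< 4 (n<4^h ⌊ n /2⌋ n≤1+h+h (ℕ.⌊n/2⌋-mono 3≤n)) ⟩
      4 ℕ.* 4 ^ ⌊ n /2⌋         ∎))
    where
    open ℕ.≤-Reasoning
    n<4^h : ∀ h → n ≤ suc (h ℕ.+ h) → 1 ≤ h → n < 4 ^ h
    n<4^h (suc h) n≤ _ = ℕ.≤-<-trans n≤ (2n+1<4^n h)

  -- The rational root of N = 4ʳ is 2ʳ, so the two eigenvalues ± `side` / 2 are rational.
  side : ℚ
  side = ν (2 ^ dimension)

  side² : side ℚ.* side ≡ ν (4 ^ dimension)
  side² = trans (sym (ν-* (2 ^ dimension) (2 ^ dimension))) (cong ν (begin
    2 ^ dimension ℕ.* 2 ^ dimension     ≡⟨ ℕ.^-distribˡ-+-* 2 dimension dimension ⟨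
    2 ^ (dimension ℕ.+ dimension)       ≡⟨ cong (λ k → 2 ^ (dimension ℕ.+ k)) (ℕ.+-identityʳ dimension) ⟨
    2 ^ (2 ℕ.* dimension)               ≡⟨ ℕ.^-*-assoc 2 2 dimension ⟨
    4 ^ dimension                       ∎))
    where open ≡-Reasoning

  0<side : 0ℚ ℚ.< side
  0<side = ν-mono-< (ℕ.m^n>0 2 dimension)

  -- At least three vertices force a dimension of at least 2, hence 2ʳ ≥ 4.
  side≢2 : 3 ≤ n → side ℚ.- (1ℚ ℚ.+ 1ℚ) ≢ 0ℚ
  side≢2 3≤n eq = ℚ.<⇒≢ (ν-mono-< {2} {2 ^ dimension} 2<) (sym (p-q≡0⇒p≡q side (1ℚ ℚ.+ 1ℚ) eq))
    where
    2< : 2 < 2 ^ dimension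
    2< = ℕ.≤-trans (s≤s (s≤s (s≤s z≤n))) (ℕ.^-monoʳ-≤ 2 {2} {dimension} (s≤s (ℕ.⌊n/2⌋-mono 3≤n)))

open import Data.Nat.Base using (_+_)

theorem8 : ∀ (t n : ℕ) → 3 ≤ t → (Δ : Graph n) → #valencies Δ ≡ t →
    ∃[ m ] Σ[ Γ ∈ Graph m ]
    ( m ≤ 2 ^ (n + 2)
    × Connected Γ
    × HasExactlyDistinctEigenvalues 4 (adjacencyMatrix Γ)
    × t ≤ #valencies Γ
    × ContainsInduced Γ Δ )
theorem8 .(#valencies Δ) n 3≤t Δ refl =
    4 ^ dimension n
  , Γ
  , size-bound n
  , connected (4n<size n 3≤n) (proj₁ (representative Δ first))
  , four-eigenvalues H N (sum-1≡ν (4 ^ dimension n)) H-sym H-orth H-unit H-diag irregular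
      (side n) (side² n) (0<side n) (side≢2 n 3≤n) (adjacencyMatrix Γ) (λ x y → entry (Graph.adj Γ x y))
  , #valencies-mono Δ Γ w valency-w-injective
  , w , w-injective , adj-w
  where
  3≤n : 3 ≤ n
  3≤n = ℕ.≤-trans 3≤t (#valencies≤n Δ)
  E : Embedding Δ (allFin n) (dimension n)
  E = embed (dimension n) Δ (allFin n)
    (subst (_< dimension n ℕ.+ dimension n) (sym (length-tabulate (λ i → i))) (n<dimension+dimension n))
  open Embedding E using () renaming (point to w)
  open Construction Δ (dimension n) E
  first second : Fin (#valencies Δ)
  first  = inject≤ {3} 0F 3≤t
  second = inject≤ {3} 1F 3≤t
  -- Vertices of Δ with different valencies have images with different row sums of `H`, so Γ is not
  -- regular.
  irregular : h (w (proj₁ (representative Δ first))) ≢ h (w (proj₁ (representative Δ second)))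
  irregular eq = Fin.0≢1+n (Fin.inject≤-injective 3≤t 3≤t 0F 1F
    (representative-injective Δ (h-w-injective (proj₁ (representative Δ first)) (proj₁ (representative Δ second)) eq)))
  entry : ∀ b → (if b then 1ℝ else 0ℝ) ≃ fromℚ (½ ℚ.* (1ℚ ℚ.- χ b))
  entry true  = pointwise 1ℝ (fromℚ 1ℚ) (λ _ → refl)
  entry false = pointwise 0ℝ (fromℚ 0ℚ) (λ _ → refl)
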